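{- Let $M$ be a $\lambda$-term, $\Gamma$ an environment and $\sigma$ a linear rank 2 intersection type. If $\Gamma\vdash_2 M:\sigma$ is derivable, then $\mathsf{T}(M)=(\Gamma',\sigma')$ for some environment $\Gamma'$ and type $\sigma'$, and there is a type substitution $\mathbb{S}$ such that $\mathbb{S}(\sigma')=\sigma$ and $\mathbb{S}(\Gamma')\equiv\Gamma$.
   Context: Terms are untyped $\lambda$-terms modulo $\alpha$-equivalence, with Barendregt's variable convention. $M[N/x]$ is the usual substitution, and $M[N_1/x_1,\dots,N_n/x_n]$ means the successive substitutions $(\dots(M[N_1/x_1])\dots)[N_n/x_n]$. **Types.** $\mathbb{V}$ is a countably infinite set of type variables. Linear types: $\mathbb{T}_{L0}$ is the least set with $\mathbb{T}_{L0}=\mathbb{V}\cup\{\tau_1\multimap\tau_2 \mid \tau_1,\tau_2\in\mathbb{T}_{L0}\}$. Sequences: $\mathbb{T}_{L1}=\{\tau_1\cap\dots\cap\tau_m\mid m\ge 1,\ \tau_i\in\mathbb{T}_{L0}\}$. Linear rank 2 intersection types: $\mathbb{T}_{L2}$ is the least set with $\mathbb{T}_{L2}=\mathbb{T}_{L0}\cup\{\tau\multimap\sigma\mid\tau\in\mathbb{T}_{L0},\sigma\in\mathbb{T}_{L2}\}\cup\{\tau_1\cap\dots\cap\tau_m\to\sigma\mid m\ge2,\tau_i\in\mathbb{T}_{L0},\sigma\in\mathbb{T}_{L2}\}$. The constructor $\cap$ is associative, commutative and non-idempotent. Below $\alpha$ ranges over $\mathbb{V}$, $\tau$ over $\mathbb{T}_{L0}$,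 $\vec\tau$ over $\mathbb{T}_{L1}$, $\sigma$ over $\mathbb{T}_{L2}$. **Environments.** An environment is a finite list $\Gamma=[x_1:\vec\tau_1,\dots,x_n:\vec\tau_n]$ with pairwise distinct term variables $x_i$ (consistency); $\mathrm{dom}(\Gamma)=\{x_1,\dots,x_n\}$, $\Gamma(x_i)=\vec\tau_i$. The comma denotes concatenation of lists. $\Gamma\equiv\Gamma'$ means equality up to the order of declarations. $\Gamma_x$ is $\Gamma$ with the declaration of $x$ (if any) removed. $\Gamma_1+\Gamma_2$ is the environment with domain $\mathrm{dom}(\Gamma_1)\cup\mathrm{dom}(\Gamma_2)$ given by $\Gamma_1(x)$ if $x\notin\mathrm{dom}(\Gamma_2)$, $\Gamma_2(x)$ if $x\notin\mathrm{dom}(\Gamma_1)$, and $\Gamma_1(x)\cap\Gamma_2(x)$ otherwise, listing first the variables of $\Gamma_1$ in their order, then those of $\mathrm{dom}(\Gamma_2)\setminus\mathrm{dom}(\Gamma_1)$ in the order of $\Gamma_2$; $\sum$ is iterated $+$. **Linear Rank 2 Intersection Type System.** $\Gamma\vdash_2 M:\sigma$ is derived by the following rules (all lists occurring must be environments): - (Axiom) $[x:\tau]\vdash_2 x:\tau$. - (Exchange) from $\Gamma_1,x:\vec\tau_1,y:\vec\tau_2,\Gamma_2\vdash_2 M:\sigma$ infer $\Gamma_1,y:\vec\tau_2,x:\vec\tau_1,\Gamma_2\vdash_2 M:\sigma$. - (Contraction) from $\Gamma_1,x_1:\vec\tau_1,x_2:\vec\tau_2,\Gamma_2\vdash_2 M:\sigma$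 infer $\Gamma_1,x:\vec\tau_1\cap\vec\tau_2,\Gamma_2\vdash_2 M[x/x_1,x/x_2]:\sigma$. - ($\to$ Intro) from $\Gamma,x:\tau_1\cap\dots\cap\tau_n\vdash_2 M:\sigma$ with $n\ge2$ infer $\Gamma\vdash_2\lambda x.M:\tau_1\cap\dots\cap\tau_n\to\sigma$. - ($\to$ Elim) from $\Gamma\vdash_2 M_1:\tau_1\cap\dots\cap\tau_n\to\sigma$ and $\Gamma_i\vdash_2 M_2:\tau_i$ for $1\le i\le n$, with $n\ge2$, infer $\Gamma,\sum_{i=1}^n\Gamma_i\vdash_2 M_1M_2:\sigma$. - ($\multimap$ Intro) from $\Gamma,x:\tau\vdash_2 M:\sigma$ infer $\Gamma\vdash_2\lambda x.M:\tau\multimap\sigma$. - ($\multimap$ Elim) from $\Gamma_1\vdash_2 M_1:\tau\multimap\sigma$ and $\Gamma_2\vdash_2 M_2:\tau$ infer $\Gamma_1,\Gamma_2\vdash_2 M_1M_2:\sigma$. **Type substitutions and unification.** A type substitution $\mathbb{S}=[\tau_1/\alpha_1,\dots,\tau_n/\alpha_n]$ (distinct $\alpha_i$, $\tau_i\in\mathbb{T}_{L0}$) acts by simultaneous replacement on types, sequences and (componentwise) environments. A unification problem $P$ is a finite set of equations between types of $\mathbb{T}_{L0}$. The relation $\Rightarrow$ is: $\{\tau=\tau\}\cup P\Rightarrow P$; $\{\tau_1\multimap\tau_2=\tau_3\multimap\tau_4\}\cup P\Rightarrow\{\tau_1=\tau_3,\tau_2=\tau_4\}\cup P$; $\{\tau_1\multimap\tau_2=\alpha\}\cup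 P\Rightarrow\{\alpha=\tau_1\multimap\tau_2\}\cup P$; $\{\alpha=\tau\}\cup P\Rightarrow\{\alpha=\tau\}\cup P[\tau/\alpha]$ if $\alpha$ occurs in $P$ and not in $\tau$; $\{\alpha=\tau\}\cup P\Rightarrow\mathsf{FAIL}$ if $\alpha$ occurs in $\tau$ and $\alpha\ne\tau$. $\mathsf{UNIFY}(P)$ applies $\Rightarrow$ as long as possible; if the result is a solved form $\{\alpha_1=\tau_1,\dots,\alpha_n=\tau_n\}$ ($\alpha_i$ pairwise distinct, occurring in no $\tau_j$) it returns $[\tau_1/\alpha_1,\dots,\tau_n/\alpha_n]$ (a most general unifier of the original problem), otherwise it fails. **Type inference algorithm $\mathsf{T}$.** "New" type variables are fresh; separate recursive calls use different fresh variables; results are considered up to renaming of type variables. 1. $\mathsf{T}(x)=([x:\alpha],\alpha)$, $\alpha$ new. 2. If $M=\lambda x.M_1$ and $\mathsf{T}(M_1)=(\Gamma_1,\sigma_1)$: (a) if $x\notin\mathrm{dom}(\Gamma_1)$, fail; (b) if $(x:\tau)\in\Gamma_1$, $\mathsf{T}(M)=((\Gamma_1)_x,\tau\multimap\sigma_1)$; (c) if $(x:\tau_1\cap\dots\cap\tau_n)\in\Gamma_1$ with $n\ge2$, $\mathsf{T}(M)=((\Gamma_1)_x,\tau_1\cap\dots\cap\tau_n\to\sigma_1)$. 3. If $M=M_1M_2$: (a) if $\mathsf{T}(M_1)=(\Gamma_1,\alpha_1)$ and $\mathsf{T}(M_2)=(\Gamma_2,\tau_2)$, then $\mathsf{T}(M)=(\mathbb{S}(\Gamma_1+\Gamma_2),\mathbb{S}(\alpha_3))$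 with $\mathbb{S}=\mathsf{UNIFY}(\{\alpha_1=\alpha_2\multimap\alpha_3,\tau_2=\alpha_2\})$, $\alpha_2,\alpha_3$ new; (b) if $\mathsf{T}(M_1)=(\Gamma_1',\tau_1'\cap\dots\cap\tau_n'\to\sigma_1')$ with $n\ge2$ and, for each $1\le i\le n$, $\mathsf{T}(M_2)=(\Gamma_i,\tau_i)$ ($n$ separate calls, whose results may differ by renaming of type variables), then $\mathsf{T}(M)=(\mathbb{S}(\Gamma_1'+\sum_{i=1}^n\Gamma_i),\mathbb{S}(\sigma_1'))$ with $\mathbb{S}=\mathsf{UNIFY}(\{\tau_i=\tau_i'\mid1\le i\le n\})$; (c) if $\mathsf{T}(M_1)=(\Gamma_1,\tau\multimap\sigma_1)$ and $\mathsf{T}(M_2)=(\Gamma_2,\tau_2)$, then $\mathsf{T}(M)=(\mathbb{S}(\Gamma_1+\Gamma_2),\mathbb{S}(\sigma_1))$ with $\mathbb{S}=\mathsf{UNIFY}(\{\tau_2=\tau\})$; (d) otherwise fail. If a recursive call or a unification fails, the algorithm fails. $\mathsf{T}(M)=(\Gamma,\sigma)$ means that the algorithm succeeds with this result. -}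

module Defs where

open import Data.Fin.Base using (Fin; fromℕ; inject₁; _↑ˡ_)
open import Data.List.Base using (List; []; _∷_; [_]; _++_; map; concatMap; filter; foldr; length; zip; zipWith)
open import Data.List.Membership.DecPropositional using () renaming (_∈?_ to member?)
open import Data.List.Membership.Propositional using (_∈_; _∉_)
open import Data.List.NonEmpty.Base as List⁺ using (List⁺; _∷_; _∷⁺_; _⁺++⁺_; toList)
open import Data.List.Relation.Binary.BagAndSetEquality using (_∼[_]_; set)
open import Data.List.Relation.Binary.Disjoint.Propositional using (Disjoint)
open import Data.List.Relation.Binary.Permutation.Homogeneous using (Permutation)
open import Data.List.Relation.Binary.Permutation.Propositional using (_↭_)
open import Data.List.Relation.Binary.Pointwise.Base using (Pointwise)
open import Data.List.Relation.Unary.All using ([])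
open import Data.List.Relation.Unary.AllPairs.Core using (AllPairs; []; _∷_)
open import Data.List.Relation.Unary.Unique.Propositional using (Unique)
open import Data.Maybe.Base using (Maybe; just; nothing; fromMaybe; maybe′)
open import Data.Nat.Base using (ℕ; zero; suc; _+_)
open import Data.Nat.Properties using (_≟_)
open import Data.Product.Base using (_×_; _,_; proj₁; proj₂; map₁; map₂; ∃-syntax) renaming (map to map×)
open import Function.Base using (_∘_)
open import Function.Definitions using (Injective)
open import Relation.Binary.Construct.Closure.ReflexiveTransitive using (Star)
open import Relation.Binary.PropositionalEquality.Core using (_≡_; _≢_)
open import Relation.Nullary using (¬_)
open import Relation.Nullary.Decidable.Core using (yes; no; ¬?)

Var TVar : Set
Var  = ℕ
TVar = ℕ

lookup : {A : Set} → ℕ → List (ℕ × A) → Maybe A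
lookup x []             = nothing
lookup x ((y , a) ∷ xs) with x ≟ y
... | yes _ = just a
... | no  _ = lookup x xs

dom : {A : Set} → List (ℕ × A) → List ℕ
dom = map proj₁

------------------------------------------------------------------------
-- λ-terms modulo α-equivalence, in locally nameless form: free variables
-- are named, bound ones are indices.  The elements of Λ = Term 0 correspond
-- exactly to α-equivalence classes, λx.M being ƛ x M.

data Term (n : ℕ) : Set where
  bvar : Fin n → Term n
  fvar : Var → Term n
  lam  : Term (suc n) → Term n
  app  : Term n → Term n → Term n

Λ : Set
Λ = Term 0

-- Binds x outside all the binders already in scope.
close : ∀ {n} → Var → Term n → Term (suc n)
close x (bvar i) = bvar (inject₁ i)
close {n} x (fvar y) with y ≟ x
... | yes _ = bvar (fromℕ n)
... | no  _ = fvar y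
close x (lam M)   = lam (close x M)
close x (app M N) = app (close x M) (close x N)

ƛ : Var → Λ → Λ
ƛ x M = lam (close x M)

weaken : ∀ {m} n → Term m → Term (m + n)
weaken n (bvar i)  = bvar (i ↑ˡ n)
weaken n (fvar x)  = fvar x
weaken n (lam M)   = lam (weaken n M)
weaken n (app M N) = app (weaken n M) (weaken n N)

-- M [ N / x ] avoids capture because the free variables of N are names.
infixl 8 _[_/_]
_[_/_] : ∀ {n} → Term n → Λ → Var → Term n
bvar i    [ N / x ] = bvar i
_[_/_] {n} (fvar y) N x with y ≟ x
... | yes _ = weaken n N
... | no  _ = fvar y
lam M     [ N / x ] = lam (M [ N / x ])
app M M′  [ N / x ] = app (M [ N / x ]) (M′ [ N / x ])

------------------------------------------------------------------------
-- Types

infixr 6 _⊸_ _∩_⇒_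

data L0 : Set where
  var : TVar → L0
  _⊸_ : L0 → L0 → L0

L1 : Set
L1 = List⁺ L0

-- τ ∩ τ⃗ ⇒ σ has the sequence τ ∷⁺ τ⃗, of length at least 2, to the left
-- of the arrow.  Linear types are included through ι rather than through a
-- constructor, since τ₁ ⊸ τ₂ with τ₂ linear would otherwise have two
-- representations.
data L2 : Set where
  var   : TVar → L2
  _⊸_   : L0 → L2 → L2
  _∩_⇒_ : L0 → L1 → L2 → L2

ι : L0 → L2
ι (var α)   = var α
ι (τ₁ ⊸ τ₂) = τ₁ ⊸ ι τ₂

-- Equality of sequences and types modulo associativity and commutativity
-- of ∩; associativity is already built into lists.

infix 4 _≈₁_ _≈₂_ _≈ᵈ_ _≋_

_≈₁_ : L1 → L1 → Set
τ⃗ ≈₁ υ⃗ = toList τ⃗ ↭ toList υ⃗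

data _≈₂_ : L2 → L2 → Set where
  var   : ∀ {α} → var α ≈₂ var α
  _⊸_   : ∀ τ {σ σ′} → σ ≈₂ σ′ → (τ ⊸ σ) ≈₂ (τ ⊸ σ′)
  _⇒_   : ∀ {τ τ⃗ υ υ⃗ σ σ′} → (τ ∷⁺ τ⃗) ≈₁ (υ ∷⁺ υ⃗) → σ ≈₂ σ′ →
          (τ ∩ τ⃗ ⇒ σ) ≈₂ (υ ∩ υ⃗ ⇒ σ′)

------------------------------------------------------------------------
-- Environments

Decl Env : Set
Decl = Var × L1
Env  = List Decl

Consistent : Env → Set
Consistent Γ = Unique (dom Γ)

infix 4 _∶_ _∶₀_
_∶_ : Var → L1 → Decl
x ∶ τ⃗ = x , τ⃗

_∶₀_ : Var → L0 → Decl
x ∶₀ τ = x , (τ ∷ [])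

_≈ᵈ_ : Decl → Decl → Set
(x , τ⃗) ≈ᵈ (y , υ⃗) = x ≡ y × τ⃗ ≈₁ υ⃗

-- The same declarations in the same order; the order may differ in _≋_.
_≈ᵉ_ : Env → Env → Set
_≈ᵉ_ = Pointwise _≈ᵈ_

_≋_ : Env → Env → Set
_≋_ = Permutation _≈ᵈ_

infixl 7 _∖_
_∖_ : Env → Var → Env
Γ ∖ x = filter (λ d → ¬? (proj₁ d ≟ x)) Γ

infixr 6 _⊞_
_⊞_ : Env → Env → Env
Γ₁ ⊞ Γ₂ =
  map (λ (x , τ⃗) → x , maybe′ (τ⃗ ⁺++⁺_) τ⃗ (lookup x Γ₂)) Γ₁
  ++ filter (λ d → ¬? (member? _≟_ (proj₁ d) (dom Γ₁))) Γ₂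

∑ : List Env → Env
∑ = foldr _⊞_ []

------------------------------------------------------------------------
-- The linear rank 2 intersection type system

-- Consistency is required where it is not inherited from the premises.
-- The rule conv expresses that types are taken modulo AC of ∩.

infix 3 _⊢₂_∶_

data _⊢₂_∶_ : Env → Λ → L2 → Set where

  axiom : ∀ {x τ} → [ x ∶₀ τ ] ⊢₂ fvar x ∶ ι τ

  exchange : ∀ {Γ₁ Γ₂ x y τ⃗₁ τ⃗₂ M σ} →
    Γ₁ ++ (x ∶ τ⃗₁) ∷ (y ∶ τ⃗₂) ∷ Γ₂ ⊢₂ M ∶ σ →
    Γ₁ ++ (y ∶ τ⃗₂) ∷ (x ∶ τ⃗₁) ∷ Γ₂ ⊢₂ M ∶ σ

  contraction : ∀ {Γ₁ Γ₂ x x₁ x₂ τ⃗₁ τ⃗₂ M σ} →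
    Consistent (Γ₁ ++ (x ∶ τ⃗₁ ⁺++⁺ τ⃗₂) ∷ Γ₂) →
    Γ₁ ++ (x₁ ∶ τ⃗₁) ∷ (x₂ ∶ τ⃗₂) ∷ Γ₂ ⊢₂ M ∶ σ →
    Γ₁ ++ (x ∶ τ⃗₁ ⁺++⁺ τ⃗₂) ∷ Γ₂ ⊢₂ M [ fvar x / x₁ ] [ fvar x / x₂ ] ∶ σ

  →-intro : ∀ {Γ x τ τ⃗ M σ} →
    Γ ++ [ x ∶ τ ∷⁺ τ⃗ ] ⊢₂ M ∶ σ →
    Γ ⊢₂ ƛ x M ∶ τ ∩ τ⃗ ⇒ σ

  →-elim : ∀ {Γ Γs τ τ⃗ M₁ M₂ σ} →
    Consistent (Γ ++ ∑ Γs) →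
    Γ ⊢₂ M₁ ∶ τ ∩ τ⃗ ⇒ σ →
    Pointwise (λ Γᵢ τᵢ → Γᵢ ⊢₂ M₂ ∶ ι τᵢ) Γs (τ ∷ toList τ⃗) →
    Γ ++ ∑ Γs ⊢₂ app M₁ M₂ ∶ σ

  ⊸-intro : ∀ {Γ x τ M σ} →
    Γ ++ [ x ∶₀ τ ] ⊢₂ M ∶ σ →
    Γ ⊢₂ ƛ x M ∶ τ ⊸ σ

  ⊸-elim : ∀ {Γ₁ Γ₂ τ M₁ M₂ σ} →
    Consistent (Γ₁ ++ Γ₂) →
    Γ₁ ⊢₂ M₁ ∶ τ ⊸ σ →
    Γ₂ ⊢₂ M₂ ∶ ι τ →
    Γ₁ ++ Γ₂ ⊢₂ app M₁ M₂ ∶ σ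

  conv : ∀ {Γ Γ′ M σ σ′} →
    Γ ≈ᵉ Γ′ → σ ≈₂ σ′ →
    Γ ⊢₂ M ∶ σ →
    Γ′ ⊢₂ M ∶ σ′

------------------------------------------------------------------------
-- Type substitutions

sub₀ : (TVar → L0) → L0 → L0
sub₀ f (var α)   = f α
sub₀ f (τ₁ ⊸ τ₂) = sub₀ f τ₁ ⊸ sub₀ f τ₂

sub₁ : (TVar → L0) → L1 → L1
sub₁ f = List⁺.map (sub₀ f)

sub₂ : (TVar → L0) → L2 → L2
sub₂ f (var α)      = ι (f α)
sub₂ f (τ ⊸ σ)      = sub₀ f τ ⊸ sub₂ f σ
sub₂ f (τ ∩ τ⃗ ⇒ σ) = sub₀ f τ ∩ sub₁ f τ⃗ ⇒ sub₂ f σ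

subᵉ : (TVar → L0) → Env → Env
subᵉ f = map (map₂ (sub₁ f))

record Subst : Set where
  constructor mkSubst
  field
    bindings : List (TVar × L0)
    distinct : Unique (dom bindings)

open Subst public

⟦_⟧ : Subst → TVar → L0
⟦ S ⟧ α = fromMaybe (var α) (lookup α (bindings S))

single : L0 → TVar → Subst
single τ α = mkSubst [ α , τ ] ([] ∷ [])

tv₀ : L0 → List TVar
tv₀ (var α)   = [ α ]
tv₀ (τ₁ ⊸ τ₂) = tv₀ τ₁ ++ tv₀ τ₂

tv₁ : L1 → List TVar
tv₁ τ⃗ = concatMap tv₀ (toList τ⃗)

tv₂ : L2 → List TVar
tv₂ (var α)      = [ α ]
tv₂ (τ ⊸ σ)      = tv₀ τ ++ tv₂ σ
tv₂ (τ ∩ τ⃗ ⇒ σ) = tv₀ τ ++ tv₁ τ⃗ ++ tv₂ σ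

tvᵉ : Env → List TVar
tvᵉ = concatMap (tv₁ ∘ proj₂)

------------------------------------------------------------------------
-- Unification

Equation Problem : Set
Equation = L0 × L0
Problem  = List Equation

tvᴾ : Problem → List TVar
tvᴾ = concatMap (λ (τ₁ , τ₂) → tv₀ τ₁ ++ tv₀ τ₂)

infixl 8 _[_/_]ᴾ
_[_/_]ᴾ : Problem → L0 → TVar → Problem
P [ τ / α ]ᴾ = map (map× (sub₀ ⟦ single τ α ⟧) (sub₀ ⟦ single τ α ⟧)) P

-- Problems are sets: lists up to _∼[ set ]_.  The decomposition of P as
-- {e} ∪ P₀ is disjoint, since otherwise an equation of a solved form could
-- be used to rewrite itself.
infix 4 _≐_⊎_
_≐_⊎_ : Problem → Equation → Problem → Set
P ≐ e ⊎ P₀ = P ∼[ set ] (e ∷ P₀) × e ∉ P₀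

data Outcome : Set where
  FAIL : Outcome
  ok   : Problem → Outcome

infix 4 _⟹_ _⟹*_

data _⟹_ (P : Problem) : Outcome → Set where

  delete : ∀ {τ P₀} →
    P ≐ (τ , τ) ⊎ P₀ →
    P ⟹ ok P₀

  decompose : ∀ {τ₁ τ₂ τ₃ τ₄ P₀} →
    P ≐ (τ₁ ⊸ τ₂ , τ₃ ⊸ τ₄) ⊎ P₀ →
    P ⟹ ok ((τ₁ , τ₃) ∷ (τ₂ , τ₄) ∷ P₀)

  orient : ∀ {τ₁ τ₂ α P₀} →
    P ≐ (τ₁ ⊸ τ₂ , var α) ⊎ P₀ →
    P ⟹ ok ((var α , τ₁ ⊸ τ₂) ∷ P₀)

  eliminate : ∀ {α τ P₀} →
    P ≐ (var α , τ) ⊎ P₀ →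
    α ∈ tvᴾ P₀ → α ∉ tv₀ τ →
    P ⟹ ok ((var α , τ) ∷ P₀ [ τ / α ]ᴾ)

  occurs : ∀ {α τ P₀} →
    P ≐ (var α , τ) ⊎ P₀ →
    α ∈ tv₀ τ → var α ≢ τ →
    P ⟹ FAIL

_⟹*_ : Problem → Problem → Set
_⟹*_ = Star (λ P Q → P ⟹ ok Q)

Irreducible : Problem → Set
Irreducible P = ∀ {O} → ¬ (P ⟹ O)

-- The equations of P are exactly α = τ for the bindings τ / α of S, and
-- they are in solved form.
IsSolvedForm : Problem → Subst → Set
IsSolvedForm P S =
  P ∼[ set ] map (map₁ var) (bindings S) ×
  Disjoint (dom (bindings S)) (concatMap (tv₀ ∘ proj₂) (bindings S))

-- UNIFY(P) succeeds with result S.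
Unify : Problem → Subst → Set
Unify P S = ∃[ Q ] P ⟹* Q × Irreducible Q × IsSolvedForm Q S

------------------------------------------------------------------------
-- Type inference

tvᴿ : Env → L2 → List TVar
tvᴿ Γ σ = tvᵉ Γ ++ tv₂ σ

-- T M Γ σ: the algorithm succeeds on M with result (Γ , σ).  There is no
-- rule where the algorithm fails.  The results for separate calls are
-- required to share no type variables; the rules rename and conv express
-- that results are taken up to renaming of type variables and that types
-- are taken modulo AC of ∩.
data T : Λ → Env → L2 → Set where

  T-var : ∀ {x α} → T (fvar x) [ x ∶₀ var α ] (var α)

  T-lam⊸ : ∀ {x M₁ Γ₁ σ₁ τ} →
    T M₁ Γ₁ σ₁ →
    (x ∶₀ τ) ∈ Γ₁ →
    T (ƛ x M₁) (Γ₁ ∖ x) (τ ⊸ σ₁)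

  T-lam→ : ∀ {x M₁ Γ₁ σ₁ τ τ⃗} →
    T M₁ Γ₁ σ₁ →
    (x ∶ τ ∷⁺ τ⃗) ∈ Γ₁ →
    T (ƛ x M₁) (Γ₁ ∖ x) (τ ∩ τ⃗ ⇒ σ₁)

  T-app-var : ∀ {M₁ M₂ Γ₁ Γ₂ α₁ α₂ α₃ τ₂ S} →
    T M₁ Γ₁ (var α₁) →
    T M₂ Γ₂ (ι τ₂) →
    Disjoint (tvᴿ Γ₁ (var α₁)) (tvᴿ Γ₂ (ι τ₂)) →
    α₂ ∉ tvᴿ Γ₁ (var α₁) ++ tvᴿ Γ₂ (ι τ₂) →
    α₃ ∉ tvᴿ Γ₁ (var α₁) ++ tvᴿ Γ₂ (ι τ₂) →
    α₂ ≢ α₃ →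
    Unify ((var α₁ , var α₂ ⊸ var α₃) ∷ (τ₂ , var α₂) ∷ []) S →
    T (app M₁ M₂) (subᵉ ⟦ S ⟧ (Γ₁ ⊞ Γ₂)) (sub₂ ⟦ S ⟧ (var α₃))

  T-app→ : ∀ {M₁ M₂ Γ₁′ τ′ τ⃗′ σ₁′ Γs τs S} →
    T M₁ Γ₁′ (τ′ ∩ τ⃗′ ⇒ σ₁′) →
    Pointwise (λ Γᵢ τᵢ → T M₂ Γᵢ (ι τᵢ)) Γs τs →
    length τs ≡ length (τ′ ∷ toList τ⃗′) →
    AllPairs Disjoint
      (tvᴿ Γ₁′ (τ′ ∩ τ⃗′ ⇒ σ₁′) ∷ zipWith (λ Γᵢ τᵢ → tvᴿ Γᵢ (ι τᵢ)) Γs τs) →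
    Unify (zip τs (τ′ ∷ toList τ⃗′)) S →
    T (app M₁ M₂) (subᵉ ⟦ S ⟧ (Γ₁′ ⊞ ∑ Γs)) (sub₂ ⟦ S ⟧ σ₁′)

  T-app⊸ : ∀ {M₁ M₂ Γ₁ Γ₂ τ σ₁ τ₂ S} →
    T M₁ Γ₁ (τ ⊸ σ₁) →
    T M₂ Γ₂ (ι τ₂) →
    Disjoint (tvᴿ Γ₁ (τ ⊸ σ₁)) (tvᴿ Γ₂ (ι τ₂)) →
    Unify ((τ₂ , τ) ∷ []) S →
    T (app M₁ M₂) (subᵉ ⟦ S ⟧ (Γ₁ ⊞ Γ₂)) (sub₂ ⟦ S ⟧ σ₁)

  rename : ∀ {M Γ σ} {ρ : TVar → TVar} →
    Injective _≡_ _≡_ ρ →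
    T M Γ σ →
    T M (subᵉ (var ∘ ρ) Γ) (sub₂ (var ∘ ρ) σ)

  conv : ∀ {M Γ Γ′ σ σ′} →
    Γ ≈ᵉ Γ′ → σ ≈₂ σ′ →
    T M Γ σ →
    T M Γ′ σ′

-- Up to order, an environment is a multiset of linear declarations x : τ, on
-- which typing becomes syntax-directed: exchange disappears and contraction
-- is a renaming of term variables.  By induction on such a derivation, T
-- succeeds with a result of which the derived judgement is an instance.  For
-- an application the results of the recursive calls are renamed apart, so
-- that their instantiations combine into a single one; it solves the
-- unification problem, hence UNIFY succeeds, and it factors through the
-- unifier found.

{-# OPTIONS --safe #-}
module Submission where

open import Defs
open import Data.Product.Base using (_×_; ∃-syntax)

open import Data.List.Base
  using (List; []; _∷_; [_]; _++_; map; concat; concatMap; filter; length; zip; zipWith; deduplicate)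
open import Data.List.Extrema.Nat using (max; xs≤max)
open import Data.List.Membership.DecPropositional using () renaming (_∈?_ to member?)
open import Data.List.Membership.Propositional using (_∈_; _∉_)
open import Data.List.Membership.Propositional.Properties
  using (∈-++⁺ˡ; ∈-++⁺ʳ; ∈-++⁻; ∈-map⁺; ∈-map⁻; ∈-filter⁺; ∈-filter⁻; ∈-deduplicate⁺)
open import Data.List.NonEmpty.Base using (_∷_; _∷⁺_; _⁺++⁺_; toList)
open import Data.List.Properties
  using ( map-++; map-∘; map-id; map-cong; map-cong-local; ++-identityʳ; ++-assoc
        ; filter-all; filter-none; filter-accept; filter-reject; filter-++; filter-notAll
        ; concat-map; concatMap-++; concatMap-map; concatMap-cong; map-concatMap; length-map; ∷-injective)
open import Data.List.Relation.Binary.BagAndSetEquality using (_∼[_]_; set)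
open import Data.List.Relation.Binary.Disjoint.Propositional using (Disjoint)
import Data.List.Relation.Binary.Permutation.Homogeneous as Hom
open import Data.List.Relation.Binary.Permutation.Propositional as Perm
  using (_↭_; ↭-refl; ↭-sym; ↭-trans; ↭-reflexive; ↭-prep; module PermutationReasoning)
open import Data.List.Relation.Binary.Permutation.Propositional.Properties
  using ( map⁺; ++⁺; ++⁺ˡ; ++-comm; shift; shifts; filter-↭; ∈-resp-↭
        ; ¬x∷xs↭[]; ↭-length; ↭-singleton-inv)
import Data.List.Relation.Binary.Permutation.Setoid.Properties as Permₛ
open import Data.List.Relation.Binary.Pointwise as Pointwise using (Pointwise; []; _∷_)
open import Data.List.Relation.Binary.Subset.Propositional using (_⊆_)
open import Data.List.Relation.Unary.All as All using (All; []; _∷_)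
import Data.List.Relation.Unary.All.Properties as All
open import Data.List.Relation.Unary.AllPairs as AllPairs using (AllPairs; []; _∷_)
import Data.List.Relation.Unary.AllPairs.Properties as AllPairs
open import Data.List.Relation.Unary.Any as Any using (here; there)
open import Data.List.Relation.Unary.Unique.DecPropositional.Properties using (deduplicate-!)
open import Data.List.Relation.Unary.Unique.Propositional using (Unique)
import Data.List.Relation.Unary.Unique.Propositional.Properties as Unique
open import Data.Maybe.Base using (just; nothing; maybe′; fromMaybe)
open import Data.Nat.Base using (ℕ; zero; suc; _+_; _≤_; _<_; s≤s)
open import Data.Nat.Properties
  using (_≟_; ≤-refl; ≤-reflexive; ≤-trans; ≤-pred; m≤m+n; m≤n+m; n≤1+n; 1+n≰n; <-irrefl)
open import Data.Nat.Solver using (module +-*-Solver)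
open import Data.Product.Base using (_,_; proj₁; proj₂; map₁; map₂)
open import Data.Product.Properties using () renaming (≡-dec to ×-≡-dec)
open import Data.Sum.Base as Sum using (_⊎_; inj₁; inj₂)
open import Function.Base using (_∘_; id)
open import Function.Bundles using (mk⇔; module Equivalence)
open import Function.Definitions using (Injective)
open import Relation.Binary.Construct.Closure.ReflexiveTransitive using (ε; _◅_)
open import Relation.Binary.Definitions using (DecidableEquality)
open import Relation.Binary.PropositionalEquality
  using (_≡_; _≢_; refl; sym; trans; cong; cong₂; subst; subst₂; setoid; module ≡-Reasoning)
open import Relation.Nullary using (¬_; Dec; yes; no; ¬?; contradiction)
open import Relation.Unary using (Decidable)

-- The two sides treat a variable shared by a function and its argument differently: `_⊢₂_∶_` keeps
-- the two environments disjoint and contracts afterwards, whereas `T` merges them at once by `_⊞_`.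
-- On flattened environments both become concatenation, and `_≋_` together with the commutativity of
-- ∩ becomes a single permutation. Success of UNIFY has to be exhibited as a reduction sequence
-- ending in an irreducible solved form. The derivation supplies a unifier `f` in advance: it
-- excludes FAIL, it survives every step, and it absorbs the substitution read off at the end.
-- Instantiations are total functions on type variables, since those of separate results have to be
-- glued together; only the last one is cut down to a finite `Subst`.

-- Instances of linear types

sub₀-cong : ∀ {f g} τ → (∀ {α} → α ∈ tv₀ τ → f α ≡ g α) → sub₀ f τ ≡ sub₀ g τ
sub₀-cong (var α)   f≗g = f≗g (here refl)
sub₀-cong (τ₁ ⊸ τ₂) f≗g =
  cong₂ _⊸_ (sub₀-cong τ₁ (f≗g ∘ ∈-++⁺ˡ)) (sub₀-cong τ₂ (f≗g ∘ ∈-++⁺ʳ (tv₀ τ₁)))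

sub₀-var : ∀ τ → sub₀ var τ ≡ τ
sub₀-var (var α)   = refl
sub₀-var (τ₁ ⊸ τ₂) = cong₂ _⊸_ (sub₀-var τ₁) (sub₀-var τ₂)

sub₀-∘ : ∀ f g τ → sub₀ f (sub₀ g τ) ≡ sub₀ (sub₀ f ∘ g) τ
sub₀-∘ f g (var α)   = refl
sub₀-∘ f g (τ₁ ⊸ τ₂) = cong₂ _⊸_ (sub₀-∘ f g τ₁) (sub₀-∘ f g τ₂)

sub₀-absorb : ∀ {f g} → (∀ α → sub₀ f (g α) ≡ f α) → ∀ τ → sub₀ f (sub₀ g τ) ≡ sub₀ f τ
sub₀-absorb {f} {g} fg τ = trans (sub₀-∘ f g τ) (sub₀-cong τ λ {α} _ → fg α)

lookup-just⁻ : {A : Set} {x : ℕ} {a : A} (xs : List (ℕ × A)) → lookup x xs ≡ just a → (x , a) ∈ xs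
lookup-just⁻ {x = x} ((y , b) ∷ xs) eq with x ≟ y
lookup-just⁻ ((y , b) ∷ xs) refl | yes refl = here refl
... | no _ = there (lookup-just⁻ xs eq)

-- The form in which "`f` factors through a substitution" is carried along: the second factor is `f`
-- itself, as `solves⇒absorbs` makes explicit.
Solves : (TVar → L0) → List (TVar × L0) → Set
Solves f B = ∀ {α τ} → (α , τ) ∈ B → f α ≡ sub₀ f τ

Unifies : (TVar → L0) → Problem → Set
Unifies f = All (λ (l , r) → sub₀ f l ≡ sub₀ f r)

solves⇒absorbs : ∀ {f} S → Solves f (bindings S) → ∀ α → sub₀ f (⟦ S ⟧ α) ≡ f α
solves⇒absorbs S sol α with lookup α (bindings S) in eq
... | just τ  = sym (sol (lookup-just⁻ (bindings S) eq))
... | nothing = refl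

-- Unification of unifiable problems

infix 4 _≟₀_
_≟₀_ : DecidableEquality L0
var α   ≟₀ var β with α ≟ β
... | yes refl = yes refl
... | no  α≢β  = no λ { refl → α≢β refl }
var _   ≟₀ (_ ⊸ _) = no λ ()
(_ ⊸ _) ≟₀ var _   = no λ ()
(a ⊸ b) ≟₀ (c ⊸ d) with a ≟₀ c | b ≟₀ d
... | yes refl | yes refl = yes refl
... | no  a≢c  | _        = no λ { refl → a≢c refl }
... | _        | no  b≢d  = no λ { refl → b≢d refl }

⊸-injˡ : {a b c d : L0} → _≡_ {A = L0} (a ⊸ b) (c ⊸ d) → a ≡ c
⊸-injˡ refl = refl

⊸-injʳ : {a b c d : L0} → _≡_ {A = L0} (a ⊸ b) (c ⊸ d) → b ≡ d
⊸-injʳ refl = refl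

size : L0 → ℕ
size (var _)   = 0
size (τ₁ ⊸ τ₂) = suc (size τ₁ + size τ₂)

∈⇒size≤ : ∀ f {α} τ → α ∈ tv₀ τ → size (f α) ≤ size (sub₀ f τ)
∈⇒size≤ f (var _)   (here refl) = ≤-refl
∈⇒size≤ f (τ₁ ⊸ τ₂) α∈ with ∈-++⁻ (tv₀ τ₁) α∈
... | inj₁ α∈τ₁ = ≤-trans (∈⇒size≤ f τ₁ α∈τ₁) (≤-trans (m≤m+n _ _) (n≤1+n _))
... | inj₂ α∈τ₂ = ≤-trans (∈⇒size≤ f τ₂ α∈τ₂) (≤-trans (m≤n+m _ _) (n≤1+n _))

-- A type properly containing `α` stays strictly larger than `α` under every instantiation, so the
-- two sizes differ. This is what rules out FAIL in the presence of a unifier.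
occurs-check : ∀ {f α} τ → α ∈ tv₀ τ → var α ≢ τ → f α ≢ sub₀ f τ
occurs-check (var _) (here refl) α≢τ _ = α≢τ refl
occurs-check {f} {α} (τ₁ ⊸ τ₂) α∈ _ eq =
  <-irrefl refl (≤-trans smaller (≤-reflexive (sym (cong size eq))))
  where
  smaller : size (f α) < size (sub₀ f (τ₁ ⊸ τ₂))
  smaller with ∈-++⁻ (tv₀ τ₁) α∈
  ... | inj₁ α∈τ₁ = s≤s (≤-trans (∈⇒size≤ f τ₁ α∈τ₁) (m≤m+n _ _))
  ... | inj₂ α∈τ₂ = s≤s (≤-trans (∈⇒size≤ f τ₂ α∈τ₂) (m≤n+m _ _))

-- Left-hand sides count double, so that `orient`, which moves an arrow type from left to right,
-- lowers the weight. The `suc` pays for dropping an equation. Decomposition loses an arrow on each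
-- side, worth three, and gains one equation, worth one.
weight : Problem → ℕ
weight []            = 0
weight ((l , r) ∷ P) = suc (size l + size l + size r + weight P)

single-≢ : ∀ {τ α β} → β ≢ α → ⟦ single τ α ⟧ β ≡ var β
single-≢ {α = α} {β} β≢α with β ≟ α
... | yes β≡α = contradiction β≡α β≢α
... | no _    = refl

single-absorbed : ∀ {f α τ} → f α ≡ sub₀ f τ → ∀ β → sub₀ f (⟦ single τ α ⟧ β) ≡ f β
single-absorbed {τ = τ} fα = solves⇒absorbs (single τ _) λ { (here refl) → fα }

single-∉ : ∀ {τ α} υ → α ∉ tv₀ υ → sub₀ ⟦ single τ α ⟧ υ ≡ υ
single-∉ υ α∉ = trans (sub₀-cong υ λ β∈ → single-≢ λ { refl → α∉ β∈ }) (sub₀-var υ)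

tv₀-single : ∀ {τ α β} υ → β ∈ tv₀ (sub₀ ⟦ single τ α ⟧ υ) → β ∈ tv₀ τ ⊎ (β ∈ tv₀ υ × β ≢ α)
tv₀-single {τ} {α} (var γ) β∈ with γ ≟ α
... | yes refl = inj₁ β∈
tv₀-single (var γ) (here refl) | no γ≢α = inj₂ (here refl , γ≢α)
tv₀-single (υ₁ ⊸ υ₂) β∈ with ∈-++⁻ (tv₀ (sub₀ _ υ₁)) β∈
... | inj₁ p = Sum.map₂ (map₁ ∈-++⁺ˡ) (tv₀-single υ₁ p)
... | inj₂ p = Sum.map₂ (map₁ (∈-++⁺ʳ (tv₀ υ₁))) (tv₀-single υ₂ p)

tvᴾ-single : ∀ {τ α β} P → β ∈ tvᴾ (P [ τ / α ]ᴾ) → β ∈ tv₀ τ ⊎ (β ∈ tvᴾ P × β ≢ α)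
tvᴾ-single ((l , r) ∷ P) β∈ with ∈-++⁻ (tv₀ (sub₀ _ l) ++ tv₀ (sub₀ _ r)) β∈
... | inj₁ p = Sum.map₂ (map₁ ∈-++⁺ˡ) (tv₀-single (l ⊸ r) p)
... | inj₂ p = Sum.map₂ (map₁ (∈-++⁺ʳ (tv₀ l ++ tv₀ r))) (tvᴾ-single P p)

ᴾ-∉ : ∀ {τ α} P → α ∉ tvᴾ P → P [ τ / α ]ᴾ ≡ P
ᴾ-∉ []            α∉ = refl
ᴾ-∉ ((l , r) ∷ P) α∉ = cong₂ _∷_
  (cong₂ _,_ (single-∉ l (α∉ ∘ ∈-++⁺ˡ ∘ ∈-++⁺ˡ)) (single-∉ r (α∉ ∘ ∈-++⁺ˡ ∘ ∈-++⁺ʳ (tv₀ l))))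
  (ᴾ-∉ P (α∉ ∘ ∈-++⁺ʳ (tv₀ l ++ tv₀ r)))

tvᴾ-∈⁻ : ∀ {α} P → α ∈ tvᴾ P → ∃[ l ] ∃[ r ] ((l , r) ∈ P × α ∈ tv₀ l ++ tv₀ r)
tvᴾ-∈⁻ ((l , r) ∷ P) α∈ with ∈-++⁻ (tv₀ l ++ tv₀ r) α∈
... | inj₁ p = l , r , here refl , p
... | inj₂ p with l′ , r′ , e∈ , q ← tvᴾ-∈⁻ P p = l′ , r′ , there e∈ , q

∼-trans : {P Q R : Problem} → P ∼[ set ] Q → Q ∼[ set ] R → P ∼[ set ] R
∼-trans p q = mk⇔ (Equivalence.to q ∘ Equivalence.to p) (Equivalence.from p ∘ Equivalence.from q)

⟹-resp-∼ : ∀ {P Q O} → P ∼[ set ] Q → Q ⟹ O → P ⟹ O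
⟹-resp-∼ p (delete (q , e∉))          = delete (∼-trans p q , e∉)
⟹-resp-∼ p (decompose (q , e∉))       = decompose (∼-trans p q , e∉)
⟹-resp-∼ p (orient (q , e∉))          = orient (∼-trans p q , e∉)
⟹-resp-∼ p (eliminate (q , e∉) α∈ α∉) = eliminate (∼-trans p q , e∉) α∈ α∉
⟹-resp-∼ p (occurs (q , e∉) α∈ α≢)    = occurs (∼-trans p q , e∉) α∈ α≢

∼-sym : {P Q : Problem} → P ∼[ set ] Q → Q ∼[ set ] P
∼-sym p = mk⇔ (Equivalence.from p) (Equivalence.to p)

-- A nonempty sequence absorbs the equivalence into the decomposition made by its first step; an
-- empty one absorbs it into irreducibility and the solved form.
Unify-resp-∼ : ∀ {P Q S} → P ∼[ set ] Q → Unify Q S → Unify P S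
Unify-resp-∼ {P} p (_ , ε , irr , (q , d)) =
  P , ε , (λ s → irr (⟹-resp-∼ (∼-sym p) s)) , (∼-trans p q , d)
Unify-resp-∼ p (R , s ◅ ss , rest) = R , ⟹-resp-∼ p s ◅ ss , rest

Unify-step : ∀ {P Q S} → P ⟹ ok Q → Unify Q S → Unify P S
Unify-step s (R , ss , rest) = R , s ◅ ss , rest

equations : List (TVar × L0) → Problem
equations = map (map₁ var)

range : List (TVar × L0) → List TVar
range = concatMap (tv₀ ∘ proj₂)

range-∈ : ∀ {α β υ} {B : List (TVar × L0)} → (β , υ) ∈ B → α ∈ tv₀ υ → α ∈ range B
range-∈ (here refl) α∈ = ∈-++⁺ˡ α∈
range-∈ {B = (_ , τ) ∷ _} (there p) α∈ = ∈-++⁺ʳ (tv₀ τ) (range-∈ p α∈)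

Unique-functional : ∀ {α} {τ υ : L0} {B} → Unique (dom B) → (α , τ) ∈ B → (α , υ) ∈ B → τ ≡ υ
Unique-functional _ (here refl) (here refl) = refl
Unique-functional (α∉ ∷ _) (here refl) (there q) = contradiction refl (All.lookup α∉ (∈-map⁺ proj₁ q))
Unique-functional (α∉ ∷ _) (there p) (here refl) = contradiction refl (All.lookup α∉ (∈-map⁺ proj₁ p))
Unique-functional (_ ∷ u) (there p) (there q) = Unique-functional u p q

-- Left-hand sides are variables, which excludes `decompose` and `orient`; none of them occurs on
-- the right, which excludes `delete` and `occurs`. Only `eliminate` takes an argument.
solved-irreducible : ∀ {B} → Unique (dom B) → Disjoint (dom B) (range B) → Irreducible (equations B)
solved-irreducible {B} u d = go
  where
  binding : ∀ {l r} → (l , r) ∈ equations B → ∃[ α ] (l ≡ var α × (α , r) ∈ B)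
  binding p with (α , _) , q , refl ← ∈-map⁻ (map₁ var) p = α , refl , q

  head : ∀ {l r P₀} → equations B ≐ (l , r) ⊎ P₀ → (l , r) ∈ equations B
  head (p , _) = Equivalence.from p (here refl)

  acyclic : ∀ {α τ} → (α , τ) ∈ B → α ∉ tv₀ τ
  acyclic p α∈ = d (∈-map⁺ proj₁ p , range-∈ p α∈)

  go : Irreducible (equations B)
  go (delete s) with _ , refl , p ← binding (head s) = acyclic p (here refl)
  go (decompose s) with () ← proj₁ (proj₂ (binding (head s)))
  go (orient s) with () ← proj₁ (proj₂ (binding (head s)))
  go (occurs s α∈ _) with _ , refl , p ← binding (head s) = acyclic p α∈
  go (eliminate {P₀ = P₀} s@(P∼ , e∉) α∈ _)
    with _ , refl , p ← binding (head s) | l , r , e′∈ , α∈e′ ← tvᴾ-∈⁻ P₀ α∈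
    with β , refl , q ← binding (Equivalence.from P∼ (there e′∈))
    with α∈e′
  -- A second equation for the same variable is the same equation, since the domain has no
  -- repetitions; the disjointness in `_≐_⊎_` forbids this.
  ... | here refl  = e∉ (subst (λ τ → (_ , τ) ∈ P₀) (Unique-functional u q p) e′∈)
  ... | there α∈r = d (∈-map⁺ proj₁ p , range-∈ q α∈r)

middle : ∀ (e : Equation) (Q P : Problem) → (Q ++ e ∷ P) ∼[ set ] (e ∷ Q ++ P)
middle e Q P = mk⇔ to from
  where
  to : Q ++ e ∷ P ⊆ e ∷ Q ++ P
  to x∈ with ∈-++⁻ Q x∈
  ... | inj₁ p           = there (∈-++⁺ˡ p)
  ... | inj₂ (here refl) = here refl
  ... | inj₂ (there p)   = there (∈-++⁺ʳ Q p)
  from : e ∷ Q ++ P ⊆ Q ++ e ∷ P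
  from (here refl) = ∈-++⁺ʳ Q (here refl)
  from (there x∈) with ∈-++⁻ Q x∈
  ... | inj₁ p = ∈-++⁺ˡ p
  ... | inj₂ p = ∈-++⁺ʳ Q (there p)

absorb : ∀ {e : Equation} {P : Problem} → e ∈ P → (e ∷ P) ∼[ set ] P
absorb e∈ = mk⇔ (λ { (here refl) → e∈ ; (there p) → p }) there

∷-cong-∼ : ∀ {e : Equation} {P Q : Problem} → P ∼[ set ] Q → (e ∷ P) ∼[ set ] (e ∷ Q)
∷-cong-∼ p = mk⇔ (λ { (here eq) → here eq ; (there q) → there (Equivalence.to p q) })
                 (λ { (here eq) → here eq ; (there q) → there (Equivalence.from p q) })

_∈ᴾ?_ : (e : Equation) (P : Problem) → Dec (e ∈ P)
_∈ᴾ?_ = member? (×-≡-dec _≟₀_ _≟₀_)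

-- Generality is stated relative to the one unifier `f` at hand, the instantiation that comes from
-- the typing derivation.
MGU : (TVar → L0) → Problem → Set
MGU f P = ∃[ S ] (Unify P S × Solves f (bindings S))

MGU-resp-∼ : ∀ {f P Q} → P ∼[ set ] Q → MGU f Q → MGU f P
MGU-resp-∼ p (S , U , sol) = S , Unify-resp-∼ {S = S} p U , sol

MGU-step : ∀ {f P Q} → P ⟹ ok Q → MGU f Q → MGU f P
MGU-step s (S , U , sol) = S , Unify-step {S = S} s U , sol

remove-length : ∀ {α} (Vs : List TVar) → α ∈ Vs → length (filter (λ β → ¬? (β ≟ α)) Vs) < length Vs
remove-length {α} Vs α∈ = filter-notAll (λ β → ¬? (β ≟ α)) Vs (Any.map (λ { refl α≢α → α≢α refl }) α∈)

lighter-decompose : ∀ a b c d w →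
  suc (a + a + c + suc (b + b + d + w)) < suc (suc (a + b) + suc (a + b) + suc (c + d) + w)
lighter-decompose a b c d w = ≤-trans (n≤1+n _) (≤-reflexive (solve 5 (λ a b c d w →
  con 3 :+ (a :+ a :+ c :+ (con 1 :+ (b :+ b :+ d :+ w))) :=
  con 1 :+ ((con 1 :+ (a :+ b)) :+ (con 1 :+ (a :+ b)) :+ (con 1 :+ (c :+ d)) :+ w)) refl a b c d w))
  where open +-*-Solver

lighter-orient : ∀ s w → suc (suc s + w) < suc (suc s + suc s + 0 + w)
lighter-orient s w = ≤-trans (m≤m+n _ s) (≤-reflexive (solve 2 (λ s w →
  con 3 :+ (s :+ w) :+ s := con 1 :+ ((con 1 :+ s) :+ (con 1 :+ s) :+ con 0 :+ w)) refl s w))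
  where open +-*-Solver

-- The equations already solved are kept in B.  Each step either removes from
-- the remaining equations P one of their variables, listed in Vs, or makes
-- them lighter.
mgu′ : ∀ {f} n k Vs B P → length Vs ≤ n → weight P ≤ k →
  Unique (dom B) → Disjoint (dom B) (range B) → Disjoint (dom B) (tvᴾ P) → tvᴾ P ⊆ Vs →
  Solves f B → Unifies f P → MGU f (equations B ++ P)
mgu′ n k Vs B [] _ _ u d _ _ fB _ =
  mkSubst B u , (_ , ε , irr , (mk⇔ (subst (_ ∈_) eq) (subst (_ ∈_) (sym eq)) , d)) , fB
  where
  eq : equations B ++ [] ≡ equations B
  eq = ++-identityʳ _
  irr : Irreducible (equations B ++ [])
  irr = subst Irreducible (sym eq) (solved-irreducible u d)
mgu′ {f} n (suc k) Vs B (e ∷ P) Vs≤ P≤ u d dP P⊆ fB (fe ∷ fP) with e ∈ᴾ? (equations B ++ P)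
-- No rule can pick an equation that also remains in the rest. As a set, however, the problem is the
-- same without the duplicate, so it is dropped at no step.
... | yes e∈ = MGU-resp-∼ (∼-trans (middle e (equations B) P) (absorb e∈))
  (mgu′ n k Vs B P Vs≤ (≤-trans (m≤n+m _ _) (≤-pred P≤)) u d
    (λ (p , q) → dP (p , ∈-++⁺ʳ (tv₀ (proj₁ e) ++ tv₀ (proj₂ e)) q)) (P⊆ ∘ ∈-++⁺ʳ (tv₀ (proj₁ e) ++ tv₀ (proj₂ e))) fB fP)
mgu′ {f} n (suc k) Vs B ((a ⊸ b , c ⊸ d) ∷ P) Vs≤ P≤ u dB dP P⊆ fB (fe ∷ fP) | no e∉ =
  MGU-step (decompose (middle _ (equations B) P , e∉))
    (MGU-resp-∼ reorder
      (mgu′ n k Vs B P′ Vs≤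
        (≤-pred (≤-trans (lighter-decompose (size a) (size b) (size c) (size d) (weight P)) P≤))
        u dB (λ (p , q) → dP (p , vars q)) (P⊆ ∘ vars) fB (⊸-injˡ fe ∷ ⊸-injʳ fe ∷ fP)))
  where
  P′ = (a , c) ∷ (b , d) ∷ P
  reorder : ((a , c) ∷ (b , d) ∷ equations B ++ P) ∼[ set ] (equations B ++ P′)
  reorder = ∼-sym (∼-trans (middle _ (equations B) _) (∷-cong-∼ (middle _ (equations B) P)))
  vars : tvᴾ P′ ⊆ tvᴾ ((a ⊸ b , c ⊸ d) ∷ P)
  vars x∈ with ∈-++⁻ (tv₀ a ++ tv₀ c) x∈
  vars x∈ | inj₁ p with ∈-++⁻ (tv₀ a) p
  ... | inj₁ q = ∈-++⁺ˡ (∈-++⁺ˡ (∈-++⁺ˡ q))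
  ... | inj₂ q = ∈-++⁺ˡ (∈-++⁺ʳ (tv₀ a ++ tv₀ b) (∈-++⁺ˡ q))
  vars x∈ | inj₂ p with ∈-++⁻ (tv₀ b ++ tv₀ d) p
  ... | inj₂ q = ∈-++⁺ʳ (tv₀ (a ⊸ b) ++ tv₀ (c ⊸ d)) q
  ... | inj₁ q with ∈-++⁻ (tv₀ b) q
  ... | inj₁ r = ∈-++⁺ˡ (∈-++⁺ˡ (∈-++⁺ʳ (tv₀ a) r))
  ... | inj₂ r = ∈-++⁺ˡ (∈-++⁺ʳ (tv₀ a ++ tv₀ b) (∈-++⁺ʳ (tv₀ c) r))
mgu′ {f} n (suc k) Vs B ((a ⊸ b , var α) ∷ P) Vs≤ P≤ u d dP P⊆ fB (fe ∷ fP) | no e∉ =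
  MGU-step (orient (middle _ (equations B) P , e∉))
    (MGU-resp-∼ (∼-sym (middle _ (equations B) P))
      (mgu′ n k Vs B ((var α , a ⊸ b) ∷ P) Vs≤
        (≤-pred (≤-trans (lighter-orient (size a + size b) (weight P)) P≤))
        u d (λ (p , q) → dP (p , vars q)) (P⊆ ∘ vars) fB (sym fe ∷ fP)))
  where
  vars : tvᴾ ((var α , a ⊸ b) ∷ P) ⊆ tvᴾ ((a ⊸ b , var α) ∷ P)
  vars (here refl) = ∈-++⁺ˡ (∈-++⁺ʳ (tv₀ (a ⊸ b)) (here refl))
  vars (there x∈) with ∈-++⁻ (tv₀ (a ⊸ b)) x∈
  ... | inj₁ p = ∈-++⁺ˡ (∈-++⁺ˡ p)
  ... | inj₂ p = ∈-++⁺ʳ (tv₀ (a ⊸ b) ++ [ α ]) p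
mgu′ {f} n (suc k) Vs B ((var α , τ) ∷ P) Vs≤ P≤ u d dP P⊆ fB (fe ∷ fP) | no e∉ with var α ≟₀ τ
... | yes refl = MGU-step (delete (middle _ (equations B) P , e∉))
  (mgu′ n k Vs B P Vs≤ (≤-trans (m≤n+m _ _) (≤-pred P≤)) u d (λ (p , q) → dP (p , there (there q)))
    (P⊆ ∘ there ∘ there) fB fP)
... | no α≢τ with member? _≟_ α (tv₀ τ)
... | yes α∈τ = contradiction fe (occurs-check τ α∈τ α≢τ)
... | no α∉τ = eliminated n Vs≤
  where
  _* = sub₀ ⟦ single τ α ⟧
  Vs′ = filter (λ β → ¬? (β ≟ α)) Vs
  B′ = (α , τ) ∷ map (map₂ _*) B
  P′ = P [ τ / α ]ᴾ

  dom-B′ : dom B′ ≡ α ∷ dom B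
  dom-B′ = cong (α ∷_) (sym (map-∘ B))

  α∉B : α ∉ dom B
  α∉B p = dP (p , here refl)

  range-* : ∀ {β} C → β ∈ range (map (map₂ _*) C) → β ∈ tv₀ τ ⊎ (β ∈ range C × β ≢ α)
  range-* ((_ , υ) ∷ C) β∈ with ∈-++⁻ (tv₀ (υ *)) β∈
  ... | inj₁ p = Sum.map₂ (map₁ ∈-++⁺ˡ) (tv₀-single υ p)
  ... | inj₂ p = Sum.map₂ (map₁ (∈-++⁺ʳ (tv₀ υ))) (range-* C p)

  outside : ∀ {β} → β ∈ dom B′ → β ∉ tv₀ τ × (β ≢ α → β ∈ dom B)
  outside {β} β∈ with subst (β ∈_) dom-B′ β∈
  ... | here refl = α∉τ , λ β≢α → contradiction refl β≢α
  ... | there p   = (λ q → dP (p , there (∈-++⁺ˡ q))) , λ _ → p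

  dB′ : Disjoint (dom B′) (range B′)
  dB′ (p , q) with ∈-++⁻ (tv₀ τ) q
  ... | inj₁ r = proj₁ (outside p) r
  ... | inj₂ r with range-* B r
  ...   | inj₁ s          = proj₁ (outside p) s
  ...   | inj₂ (s , β≢α) = d (proj₂ (outside p) β≢α , s)

  dP′ : Disjoint (dom B′) (tvᴾ P′)
  dP′ (p , q) with tvᴾ-single P q
  ... | inj₁ r         = proj₁ (outside p) r
  ... | inj₂ (r , β≢α) = dP (proj₂ (outside p) β≢α , there (∈-++⁺ʳ (tv₀ τ) r))

  P′⊆ : tvᴾ P′ ⊆ Vs′
  P′⊆ {β} q with tvᴾ-single P q
  ... | inj₁ r         = ∈-filter⁺ _ (P⊆ (there (∈-++⁺ˡ r))) λ { refl → α∉τ r }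
  ... | inj₂ (r , β≢α) = ∈-filter⁺ _ (P⊆ (there (∈-++⁺ʳ (tv₀ τ) r))) β≢α

  -- `f` already identifies `α` with `τ`, so it cannot see the substitution and remains a unifier
  -- after it.
  f-* : ∀ υ → sub₀ f (υ *) ≡ sub₀ f υ
  f-* = sub₀-absorb (single-absorbed fe)

  fB′ : Solves f B′
  fB′ (here refl) = fe
  fB′ (there p) with (_ , υ) , q , refl ← ∈-map⁻ (map₂ _*) p = trans (fB q) (sym (f-* υ))

  fP′ : Unifies f P′
  fP′ = All.map⁺ (All.map (λ {(l , r)} fl≡fr → trans (f-* l) (trans fl≡fr (sym (f-* r)))) fP)

  equations-* : ∀ C → α ∉ dom C → equations C [ τ / α ]ᴾ ≡ equations (map (map₂ _*) C)
  equations-* []            α∉ = refl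
  equations-* ((β , υ) ∷ C) α∉ = cong₂ _∷_
    (cong (_, υ *) (single-≢ λ { refl → α∉ (here refl) })) (equations-* C (α∉ ∘ there))

  result : (var α , τ) ∷ (equations B ++ P) [ τ / α ]ᴾ ≡ equations B′ ++ P′
  result = cong (_ ∷_) (trans (map-++ _ (equations B) P) (cong (_++ P′) (equations-* B α∉B)))

  -- As `α` lies in `Vs`, the bound `n` is a successor and can be lowered. The weight may grow under
  -- the substitution: the recursion is lexicographic in the two bounds.
  eliminated : ∀ n → length Vs ≤ n → MGU f (equations B ++ (var α , τ) ∷ P)
  eliminated n Vs≤n with ≤-trans (remove-length Vs (P⊆ (here refl))) Vs≤n
  eliminated (suc n) Vs≤n | s≤s Vs′≤n
    with rec ← mgu′ n (weight P′) Vs′ B′ P′ Vs′≤n ≤-refl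
                 (subst Unique (sym dom-B′) (All.tabulate (λ p → λ { refl → α∉B p }) ∷ u))
                 dB′ dP′ P′⊆ fB′ fP′
    with member? _≟_ α (tvᴾ (equations B ++ P))
  ... | yes α∈ = MGU-step (eliminate (middle _ (equations B) P , e∉) α∈ α∉τ)
                   (subst (MGU f) (sym result) rec)
  -- `eliminate` does not apply when `α` occurs nowhere else, but then the substitution changes
  -- nothing and the equation merely passes to the solved part.
  ... | no α∉ = MGU-resp-∼ (middle _ (equations B) P)
                  (subst (MGU f) (trans (sym result) (cong (_ ∷_) (ᴾ-∉ _ α∉))) rec)

mgu : ∀ {f} P → Unifies f P → MGU f P
mgu P fP = mgu′ _ _ (tvᴾ P) [] P ≤-refl ≤-refl [] (λ ()) (λ ()) id (λ ()) fP

-- Splitting a list of declarations at a variable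

filter-filter : {A : Set} {P Q R : A → Set} (P? : Decidable P) (Q? : Decidable Q) (R? : Decidable R) →
  (∀ {a} → R a → P a × Q a) → (∀ {a} → P a → Q a → R a) →
  ∀ xs → filter R? xs ≡ filter P? (filter Q? xs)
filter-filter P? Q? R? to from [] = refl
filter-filter P? Q? R? to from (x ∷ xs) with Q? x | R? x
... | no ¬q | yes r = contradiction (proj₂ (to r)) ¬q
... | no _  | no _  = filter-filter P? Q? R? to from xs
... | yes q | r? with P? x | r?
...   | yes _ | yes _ = cong (x ∷_) (filter-filter P? Q? R? to from xs)
...   | yes p | no ¬r = contradiction (from p q) ¬r
...   | no ¬p | yes r = contradiction (proj₁ (to r)) ¬p
...   | no _  | no _  = filter-filter P? Q? R? to from xs

filter-split : {A : Set} {P : A → Set} (P? : Decidable P) →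
  ∀ xs → xs ↭ filter P? xs ++ filter (¬? ∘ P?) xs
filter-split P? [] = ↭-refl
filter-split P? (x ∷ xs) with P? x
... | yes _ = ↭-prep x (filter-split P? xs)
... | no _  = ↭-trans (↭-prep x (filter-split P? xs)) (↭-sym (shift x (filter P? xs) _))

only without : {A : Set} → ℕ → List (ℕ × A) → List (ℕ × A)
only    x = filter (λ d → proj₁ d ≟ x)
without x = filter (λ d → ¬? (proj₁ d ≟ x))

module _ {A : Set} {x : ℕ} where

  ∉⇒≢ : {Δ : List (ℕ × A)} → x ∉ dom Δ → All (λ d → ¬ (proj₁ d ≡ x)) Δ
  ∉⇒≢ x∉ = All.tabulate λ { d∈ refl → x∉ (∈-map⁺ proj₁ d∈) }

  only-∉ : {Δ : List (ℕ × A)} → x ∉ dom Δ → only x Δ ≡ []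
  only-∉ = filter-none _ ∘ ∉⇒≢

  without-∉ : {Δ : List (ℕ × A)} → x ∉ dom Δ → without x Δ ≡ Δ
  without-∉ = filter-all _ ∘ ∉⇒≢

  only-block : (as : List A) (Δ : List (ℕ × A)) → x ∉ dom Δ → only x (map (x ,_) as ++ Δ) ≡ map (x ,_) as
  only-block as Δ x∉ = trans (filter-++ _ (map (x ,_) as) Δ)
    (trans (cong₂ _++_ (filter-all _ (All.map⁺ (All.universal (λ _ → refl) as))) (only-∉ x∉)) (++-identityʳ _))

  without-block : (as : List A) (Δ : List (ℕ × A)) → x ∉ dom Δ → without x (map (x ,_) as ++ Δ) ≡ Δ
  without-block as Δ x∉ = trans (filter-++ _ (map (x ,_) as) Δ)
    (cong₂ _++_ (filter-none _ (All.map⁺ (All.universal (λ _ x≢x → x≢x refl) as))) (without-∉ x∉))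

  only-lookup : {Δ : List (ℕ × A)} {a : A} → Unique (dom Δ) → (x , a) ∈ Δ → only x Δ ≡ [ x , a ]
  only-lookup {_ ∷ Δ} (x∉ ∷ _) (here refl) = only-block [ _ ] Δ λ x∈ → All.lookup x∉ x∈ refl
  only-lookup {_ ∷ Δ} (y∉ ∷ u) (there p) =
    trans (filter-reject (λ d → proj₁ d ≟ x) λ y≡x → All.lookup y∉ (∈-map⁺ proj₁ p) y≡x) (only-lookup {Δ} u p)

  lookup-nothing⁻ : (Δ : List (ℕ × A)) → lookup x Δ ≡ nothing → x ∉ dom Δ
  lookup-nothing⁻ ((y , _) ∷ Δ) eq with x ≟ y
  lookup-nothing⁻ ((y , _) ∷ Δ) () | yes _
  ... | no x≢y = λ { (here x≡y) → x≢y x≡y ; (there p) → lookup-nothing⁻ Δ eq p }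

  lookup-without : ∀ {y} (Δ : List (ℕ × A)) → y ≢ x → lookup y (without x Δ) ≡ lookup y Δ
  lookup-without [] _ = refl
  lookup-without {y} ((z , a) ∷ Δ) y≢x with z ≟ x
  ... | yes refl = trans
    (cong (lookup y) (filter-reject (λ d → ¬? (proj₁ d ≟ x)) λ z≢z → z≢z refl))
    (trans (lookup-without Δ y≢x) (sym skip))
    where
    skip : lookup y ((z , a) ∷ Δ) ≡ lookup y Δ
    skip with y ≟ z
    ... | yes y≡z = contradiction y≡z y≢x
    ... | no _    = refl
  ... | no z≢x = trans (cong (lookup y) (filter-accept (λ d → ¬? (proj₁ d ≟ x)) z≢x)) same
    where
    same : lookup y ((z , a) ∷ without x Δ) ≡ lookup y ((z , a) ∷ Δ)
    same with y ≟ z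
    ... | yes _ = refl
    ... | no _  = lookup-without Δ y≢x

Unique-filter : {A : Set} {P : ℕ × A → Set} (P? : Decidable P) {Δ : List (ℕ × A)} →
  Unique (dom Δ) → Unique (dom (filter P? Δ))
Unique-filter P? u = AllPairs.map⁺ (AllPairs.filter⁺ P? (AllPairs.map⁻ u))

-- Environments as multisets of linear declarations

Ctx : Set
Ctx = List (Var × L0)

block : Var → L1 → Ctx
block x τ⃗ = map (x ,_) (toList τ⃗)

-- An environment up to the order of declarations and of the types in a
-- sequence is a multiset of declarations x : τ with τ linear.
flat : Env → Ctx
flat = concatMap λ (x , τ⃗) → block x τ⃗

flat-++ : ∀ Γ₁ Γ₂ → flat (Γ₁ ++ Γ₂) ≡ flat Γ₁ ++ flat Γ₂
flat-++ = concatMap-++ _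

block-↭ : ∀ x {τ⃗ υ⃗} → τ⃗ ≈₁ υ⃗ → block x τ⃗ ↭ block x υ⃗
block-↭ x = map⁺ (x ,_)

block-↭⁻ : ∀ {x τ⃗ υ⃗} → block x τ⃗ ↭ block x υ⃗ → τ⃗ ≈₁ υ⃗
block-↭⁻ {x} {τ⃗} {υ⃗} p = Perm.↭-trans (↭-reflexive (entries τ⃗))
  (Perm.↭-trans (map⁺ proj₂ p) (↭-reflexive (sym (entries υ⃗))))
  where
  entries : ∀ τ⃗ → toList τ⃗ ≡ map proj₂ (block x τ⃗)
  entries τ⃗ = trans (sym (map-id _)) (map-∘ (toList τ⃗))

flat-≈ᵉ : ∀ {Γ Γ′} → Γ ≈ᵉ Γ′ → flat Γ ↭ flat Γ′
flat-≈ᵉ [] = ↭-refl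
flat-≈ᵉ (_∷_ {x = _ , τ⃗} {y = _ , υ⃗} (refl , p) ps) = ++⁺ (block-↭ _ {τ⃗} {υ⃗} p) (flat-≈ᵉ ps)

block-dom : ∀ {x y} (τs : List L0) → y ∈ dom (map (x ,_) τs) → y ≡ x
block-dom (_ ∷ τs) (here eq) = eq
block-dom (_ ∷ τs) (there p) = block-dom τs p

flat-dom : ∀ {x} Γ → x ∈ dom (flat Γ) → x ∈ dom Γ
flat-dom {x} ((y , τ⃗) ∷ Γ) x∈
  with ∈-++⁻ (dom (block y τ⃗)) (subst (x ∈_) (map-++ proj₁ (block y τ⃗) (flat Γ)) x∈)
... | inj₁ p = here (block-dom (toList τ⃗) p)
... | inj₂ p = there (flat-dom Γ p)

flat-filter : {P : Var → Set} (P? : Decidable P) → ∀ Γ →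
  flat (filter (P? ∘ proj₁) Γ) ≡ filter (P? ∘ proj₁) (flat Γ)
flat-filter P? [] = refl
flat-filter {P} P? (d@(y , τ⃗) ∷ Γ) = begin
  flat (filter P?₁ (d ∷ Γ))                           ≡⟨ head (P? y) ⟩
  filter P?₁ (block y τ⃗) ++ flat (filter P?₁ Γ)       ≡⟨ cong (filter P?₁ (block y τ⃗) ++_) (flat-filter P? Γ) ⟩
  filter P?₁ (block y τ⃗) ++ filter P?₁ (flat Γ)       ≡⟨ filter-++ P?₁ (block y τ⃗) (flat Γ) ⟨
  filter P?₁ (flat (d ∷ Γ))                           ∎
  where
  open ≡-Reasoning
  P?₁ : ∀ {A : Set} → Decidable (P ∘ proj₁ {A = Var} {B = λ _ → A})
  P?₁ = P? ∘ proj₁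
  head : Dec (P y) → flat (filter P?₁ (d ∷ Γ)) ≡ filter P?₁ (block y τ⃗) ++ flat (filter P?₁ Γ)
  head (yes p) = trans (cong flat (filter-accept P?₁ p))
    (cong (_++ flat (filter P?₁ Γ)) (sym (filter-all P?₁ (All.map⁺ (All.universal (λ _ → p) (toList τ⃗))))))
  head (no ¬p) = trans (cong flat (filter-reject P?₁ ¬p))
    (cong (_++ flat (filter P?₁ Γ)) (sym (filter-none P?₁ (All.map⁺ (All.universal (λ _ → ¬p) (toList τ⃗))))))

flat-only : ∀ x Γ → flat (only x Γ) ≡ only x (flat Γ)
flat-only x = flat-filter (_≟ x)

flat-without : ∀ x Γ → flat (Γ ∖ x) ≡ without x (flat Γ)
flat-without x = flat-filter (λ y → ¬? (y ≟ x))

-- Splitting a list into the entries for `x` and the others respects permutations. Consistency makes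
-- the first part of `Γ` a single declaration, and nonemptiness of `τ⃗` ensures that there is one.
extract : ∀ {Γ x τ⃗ Δ} → Consistent Γ → flat Γ ↭ block x τ⃗ ++ Δ → x ∉ dom Δ →
  ∃[ υ⃗ ] ((x , υ⃗) ∈ Γ × υ⃗ ≈₁ τ⃗ × flat (Γ ∖ x) ↭ Δ)
extract {Γ} {x} {τ⃗@(_ ∷ _)} {Δ} c p x∉
  with (_ , υ⃗) , d∈ , refl ← ∈-map⁻ proj₁ (flat-dom Γ (∈-map⁺ proj₁ (∈-resp-↭ (↭-sym p) (here refl))))
  = υ⃗ , d∈ , block-↭⁻ {x} {υ⃗} {τ⃗} types , rest
  where
  open PermutationReasoning
  types : block x υ⃗ ↭ block x τ⃗
  types = begin
    block x υ⃗               ≡⟨ ++-identityʳ _ ⟨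
    flat [ x , υ⃗ ]          ≡⟨ cong flat (only-lookup c d∈) ⟨
    flat (only x Γ)         ≡⟨ flat-only x Γ ⟩
    only x (flat Γ)         ↭⟨ filter-↭ _ p ⟩
    only x (block x τ⃗ ++ Δ) ≡⟨ only-block (toList τ⃗) Δ x∉ ⟩
    block x τ⃗               ∎
  rest : flat (Γ ∖ x) ↭ Δ
  rest = begin
    flat (Γ ∖ x)               ≡⟨ flat-without x Γ ⟩
    without x (flat Γ)         ↭⟨ filter-↭ _ p ⟩
    without x (block x τ⃗ ++ Δ) ≡⟨ without-block (toList τ⃗) Δ x∉ ⟩
    Δ                          ∎

flat-lookup : ∀ {Γ x υ⃗} → Consistent Γ → (x , υ⃗) ∈ Γ → flat Γ ↭ block x υ⃗ ++ flat (Γ ∖ x)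
flat-lookup {Γ} {x} {υ⃗} c d∈ = begin
  flat Γ                                 ↭⟨ filter-split (λ d → proj₁ d ≟ x) (flat Γ) ⟩
  only x (flat Γ) ++ without x (flat Γ)  ≡⟨ cong₂ _++_ (flat-only x Γ) (flat-without x Γ) ⟨
  flat (only x Γ) ++ flat (Γ ∖ x)        ≡⟨ cong (λ Γ′ → flat Γ′ ++ flat (Γ ∖ x)) (only-lookup c d∈) ⟩
  flat [ x , υ⃗ ] ++ flat (Γ ∖ x)         ≡⟨ cong (_++ flat (Γ ∖ x)) (++-identityʳ _) ⟩
  block x υ⃗ ++ flat (Γ ∖ x)              ∎
  where open PermutationReasoning

-- The first declaration takes everything that `Γ₂` says about `x`, so the remaining ones can be
-- merged with `Γ₂ ∖ x`. This permits induction on the left operand.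
⊞-∷ : ∀ {x τ⃗} Γ₁ Γ₂ → x ∉ dom Γ₁ →
  ((x , τ⃗) ∷ Γ₁) ⊞ Γ₂ ≡ (x , maybe′ (τ⃗ ⁺++⁺_) τ⃗ (lookup x Γ₂)) ∷ Γ₁ ⊞ (Γ₂ ∖ x)
⊞-∷ {x} {τ⃗} Γ₁ Γ₂ x∉ = cong (_ ∷_) (cong₂ _++_
  (map-cong-local (All.map (λ {d} y≢x → cong (λ m → proj₁ d , maybe′ (proj₂ d ⁺++⁺_) (proj₂ d) m)
    (sym (lookup-without Γ₂ y≢x))) (∉⇒≢ x∉)))
  (filter-filter _ _ _ (λ ∉ → (∉ ∘ there) , ∉ ∘ here)
    (λ { ∉₁ ≢x (here eq) → ≢x eq ; ∉₁ ≢x (there p) → ∉₁ p }) Γ₂))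

-- Consistency matters on both sides: `lookup` sees only the first declaration of a variable in `Γ₂`
-- while the filter discards them all, and a variable repeated in `Γ₁` would collect its types from
-- `Γ₂` twice.
flat-⊞ : ∀ Γ₁ Γ₂ → Consistent Γ₁ → Consistent Γ₂ → flat (Γ₁ ⊞ Γ₂) ↭ flat Γ₁ ++ flat Γ₂
flat-⊞ [] Γ₂ _ _ = ↭-reflexive (cong flat (filter-all _ (All.universal (λ _ ()) Γ₂)))
flat-⊞ ((x , τ⃗) ∷ Γ₁) Γ₂ (x∉ ∷ c₁) c₂ = begin
  flat (((x , τ⃗) ∷ Γ₁) ⊞ Γ₂)  ≡⟨ cong flat (⊞-∷ Γ₁ Γ₂ λ x∈ → All.lookup x∉ x∈ refl) ⟩
  block x merged ++ flat (Γ₁ ⊞ (Γ₂ ∖ x))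
    ↭⟨ ++⁺ˡ (block x merged) (flat-⊞ Γ₁ (Γ₂ ∖ x) c₁ (Unique-filter _ c₂)) ⟩
  block x merged ++ flat Γ₁ ++ flat (Γ₂ ∖ x)      ↭⟨ shifts (block x merged) (flat Γ₁) ⟩
  flat Γ₁ ++ block x merged ++ flat (Γ₂ ∖ x)      ↭⟨ ++⁺ˡ (flat Γ₁) heads ⟩
  flat Γ₁ ++ block x τ⃗ ++ flat Γ₂                 ↭⟨ shifts (flat Γ₁) (block x τ⃗) ⟩
  block x τ⃗ ++ flat Γ₁ ++ flat Γ₂                 ≡⟨ ++-assoc (block x τ⃗) _ _ ⟨
  flat ((x , τ⃗) ∷ Γ₁) ++ flat Γ₂                  ∎
  where
  open PermutationReasoning
  merged = maybe′ (τ⃗ ⁺++⁺_) τ⃗ (lookup x Γ₂)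
  heads : block x merged ++ flat (Γ₂ ∖ x) ↭ block x τ⃗ ++ flat Γ₂
  heads with lookup x Γ₂ in eq
  ... | nothing = ↭-reflexive (cong (λ Γ → block x τ⃗ ++ flat Γ) (without-∉ (lookup-nothing⁻ Γ₂ eq)))
  ... | just υ⃗ = begin
    block x (τ⃗ ⁺++⁺ υ⃗) ++ flat (Γ₂ ∖ x)         
      ≡⟨ cong (_++ flat (Γ₂ ∖ x)) (map-++ (x ,_) (toList τ⃗) (toList υ⃗)) ⟩
    (block x τ⃗ ++ block x υ⃗) ++ flat (Γ₂ ∖ x)   ≡⟨ ++-assoc (block x τ⃗) _ _ ⟩
    block x τ⃗ ++ block x υ⃗ ++ flat (Γ₂ ∖ x)
      ↭⟨ ++⁺ˡ (block x τ⃗) (flat-lookup c₂ (lookup-just⁻ Γ₂ eq)) ⟨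
    block x τ⃗ ++ flat Γ₂                        ∎

⊞-consistent : ∀ {Γ₁ Γ₂} → Consistent Γ₁ → Consistent Γ₂ → Consistent (Γ₁ ⊞ Γ₂)
⊞-consistent {Γ₁} {Γ₂} c₁ c₂ = subst Unique (sym dom-⊞) (Unique.++⁺ c₁ (Unique-filter _ c₂) apart)
  where
  new = filter (λ d → ¬? (member? _≟_ (proj₁ d) (dom Γ₁))) Γ₂
  dom-⊞ : dom (Γ₁ ⊞ Γ₂) ≡ dom Γ₁ ++ dom new
  dom-⊞ = trans (map-++ proj₁ (map _ Γ₁) new) (cong (_++ dom new) (sym (map-∘ Γ₁)))
  apart : ∀ {x} → ¬ (x ∈ dom Γ₁ × x ∈ dom new)
  apart (p , q) with _ , d∈ , refl ← ∈-map⁻ proj₁ q = proj₂ (∈-filter⁻ _ {xs = Γ₂} d∈) p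

∑-consistent : ∀ {Γs} → All Consistent Γs → Consistent (∑ Γs)
∑-consistent []       = []
∑-consistent (c ∷ cs) = ⊞-consistent c (∑-consistent cs)

flat-∑ : ∀ {Γs} → All Consistent Γs → flat (∑ Γs) ↭ concatMap flat Γs
flat-∑ [] = ↭-refl
flat-∑ {Γ ∷ Γs} (c ∷ cs) = ↭-trans (flat-⊞ Γ (∑ Γs) c (∑-consistent cs)) (++⁺ˡ (flat Γ) (flat-∑ cs))

≈ᵈ-refl : ∀ {d} → d ≈ᵈ d
≈ᵈ-refl = refl , ↭-refl

↭⇒≋ : ∀ {Γ Γ′} → Γ ↭ Γ′ → Γ ≋ Γ′
↭⇒≋ Perm.refl         = Hom.refl (Pointwise.refl ≈ᵈ-refl)
↭⇒≋ (Perm.prep _ p)   = Hom.prep ≈ᵈ-refl (↭⇒≋ p)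
↭⇒≋ (Perm.swap _ _ p) = Hom.swap ≈ᵈ-refl ≈ᵈ-refl (↭⇒≋ p)
↭⇒≋ (Perm.trans p q)  = Hom.trans (↭⇒≋ p) (↭⇒≋ q)

-- Flattening loses only order: sequences are nonempty, so each variable leaves a trace, and
-- consistency gathers its entries back into one declaration.
flat-↭⇒≋ : ∀ {Γ Γ′} → Consistent Γ → Consistent Γ′ → flat Γ ↭ flat Γ′ → Γ ≋ Γ′
flat-↭⇒≋ {Γ} {[]} c c′ p = empty Γ p
  where
  empty : ∀ Γ → flat Γ ↭ [] → Γ ≋ []
  empty [] _ = Hom.refl []
  empty ((_ , (_ ∷ _)) ∷ _) q = contradiction q ¬x∷xs↭[]
flat-↭⇒≋ {Γ} {(x , τ⃗) ∷ Γ′} c (x∉ ∷ c′) p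
  with υ⃗ , d∈ , υ≈τ , q ← extract {Γ} {x} {τ⃗} c p (λ x∈ → All.lookup x∉ (flat-dom Γ′ x∈) refl)
  = Hom.trans (↭⇒≋ split) (Hom.prep (refl , υ≈τ) (flat-↭⇒≋ (Unique-filter _ c) c′ q))
  where
  split : Γ ↭ (x , υ⃗) ∷ Γ ∖ x
  split = ↭-trans (filter-split (λ d → proj₁ d ≟ x) Γ) (↭-reflexive (cong (_++ Γ ∖ x) (only-lookup c d∈)))

-- Rank 2 types, their arrows and their instances

≈₂-refl : ∀ σ → σ ≈₂ σ
≈₂-refl (var α)      = var
≈₂-refl (τ ⊸ σ)      = τ ⊸ ≈₂-refl σ
≈₂-refl (τ ∩ τ⃗ ⇒ σ) = ↭-refl ⇒ ≈₂-refl σ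

≈₂-reflexive : ∀ {σ σ′} → σ ≡ σ′ → σ ≈₂ σ′
≈₂-reflexive refl = ≈₂-refl _

≈₂-sym : ∀ {σ σ′} → σ ≈₂ σ′ → σ′ ≈₂ σ
≈₂-sym var     = var
≈₂-sym (τ ⊸ p) = τ ⊸ ≈₂-sym p
≈₂-sym (q ⇒ p) = ↭-sym q ⇒ ≈₂-sym p

≈₂-trans : ∀ {σ σ′ σ″} → σ ≈₂ σ′ → σ′ ≈₂ σ″ → σ ≈₂ σ″
≈₂-trans var var             = var
≈₂-trans (τ ⊸ p) (.τ ⊸ q)    = τ ⊸ ≈₂-trans p q
≈₂-trans (p₁ ⇒ p) (q₁ ⇒ q)   = ↭-trans p₁ q₁ ⇒ ≈₂-trans p q

-- Both arrows at once: a sequence of length 1 is the domain of a linear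
-- arrow, a longer one of an intersection arrow.
infixr 6 _⟶_
_⟶_ : L1 → L2 → L2
(τ ∷ [])     ⟶ σ = τ ⊸ σ
(τ ∷ υ ∷ υs) ⟶ σ = τ ∩ (υ ∷ υs) ⇒ σ

singleton-↭⁻ : {τ υ : L0} → [ τ ] ↭ [ υ ] → τ ≡ υ
singleton-↭⁻ p with refl ← ↭-singleton-inv p = refl

⟶-cong : ∀ τ⃗ υ⃗ {σ σ′} → τ⃗ ≈₁ υ⃗ → σ ≈₂ σ′ → (τ⃗ ⟶ σ) ≈₂ (υ⃗ ⟶ σ′)
⟶-cong (τ ∷ [])    (υ ∷ [])    p q with refl ← singleton-↭⁻ p = τ ⊸ q
⟶-cong (_ ∷ _ ∷ _) (_ ∷ _ ∷ _) p q = p ⇒ q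
⟶-cong (_ ∷ [])    (_ ∷ _ ∷ _) p q with () ← ↭-length p
⟶-cong (_ ∷ _ ∷ _) (_ ∷ [])    p q with () ← ↭-length p

ι-injective : ∀ {τ υ} → ι τ ≈₂ ι υ → τ ≡ υ
ι-injective {var _} {var _} var = refl
ι-injective {_ ⊸ _} {_ ⊸ _} (τ ⊸ p) = cong (τ ⊸_) (ι-injective p)

sub₂-ι : ∀ f τ → sub₂ f (ι τ) ≡ ι (sub₀ f τ)
sub₂-ι f (var α) = refl
sub₂-ι f (τ ⊸ υ) = cong (sub₀ f τ ⊸_) (sub₂-ι f υ)

-- Instantiation never removes an intersection arrow. Hence the results inferred for arguments are
-- linear, as the application rules of `T` require.
sub₂-ι⁻ : ∀ f σ τ → sub₂ f σ ≈₂ ι τ → ∃[ υ ] (σ ≡ ι υ × sub₀ f υ ≡ τ)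
sub₂-ι⁻ f (var α) τ p = var α , refl , ι-injective p
sub₂-ι⁻ f (τ ⊸ σ) (_ ⊸ τ′) (_ ⊸ p) with υ , refl , refl ← sub₂-ι⁻ f σ τ′ p = τ ⊸ υ , refl , refl
sub₂-ι⁻ f (_ ∩ _ ⇒ _) (var _) ()
sub₂-ι⁻ f (_ ∩ _ ⇒ _) (_ ⊸ _) ()

sub₂-⟶ : ∀ f τ⃗ σ → sub₂ f (τ⃗ ⟶ σ) ≡ sub₁ f τ⃗ ⟶ sub₂ f σ
sub₂-⟶ f (_ ∷ [])    σ = refl
sub₂-⟶ f (_ ∷ _ ∷ _) σ = refl

sub₁-cong : ∀ {f g} τ⃗ → (∀ {α} → α ∈ tv₁ τ⃗ → f α ≡ g α) → sub₁ f τ⃗ ≡ sub₁ g τ⃗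
sub₁-cong (τ ∷ τs) f≗g = cong₂ _∷_ (sub₀-cong τ (f≗g ∘ ∈-++⁺ˡ)) (go τs (f≗g ∘ ∈-++⁺ʳ (tv₀ τ)))
  where
  go : ∀ {f g} τs → (∀ {α} → α ∈ concatMap tv₀ τs → f α ≡ g α) → map (sub₀ f) τs ≡ map (sub₀ g) τs
  go []       _   = refl
  go (τ ∷ τs) f≗g = cong₂ _∷_ (sub₀-cong τ (f≗g ∘ ∈-++⁺ˡ)) (go τs (f≗g ∘ ∈-++⁺ʳ (tv₀ τ)))

sub₂-cong : ∀ {f g} σ → (∀ {α} → α ∈ tv₂ σ → f α ≡ g α) → sub₂ f σ ≡ sub₂ g σ
sub₂-cong (var α) f≗g = cong ι (f≗g (here refl))
sub₂-cong (τ ⊸ σ) f≗g = cong₂ _⊸_ (sub₀-cong τ (f≗g ∘ ∈-++⁺ˡ)) (sub₂-cong σ (f≗g ∘ ∈-++⁺ʳ (tv₀ τ)))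
sub₂-cong (τ ∩ τ⃗ ⇒ σ) f≗g = trans
  (cong₂ (λ τ τ⃗ → τ ∩ τ⃗ ⇒ _) (sub₀-cong τ (f≗g ∘ ∈-++⁺ˡ)) (sub₁-cong τ⃗ (f≗g ∘ ∈-++⁺ʳ (tv₀ τ) ∘ ∈-++⁺ˡ)))
  (cong (_ ∩ _ ⇒_) (sub₂-cong σ (f≗g ∘ ∈-++⁺ʳ (tv₀ τ) ∘ ∈-++⁺ʳ (tv₁ τ⃗))))

subᵉ-cong : ∀ {f g} Γ → (∀ {α} → α ∈ tvᵉ Γ → f α ≡ g α) → subᵉ f Γ ≡ subᵉ g Γ
subᵉ-cong [] _ = refl
subᵉ-cong ((x , τ⃗) ∷ Γ) f≗g =
  cong₂ _∷_ (cong (x ,_) (sub₁-cong τ⃗ (f≗g ∘ ∈-++⁺ˡ))) (subᵉ-cong Γ (f≗g ∘ ∈-++⁺ʳ (tv₁ τ⃗)))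

sub₁-∘ : ∀ f g τ⃗ → sub₁ f (sub₁ g τ⃗) ≡ sub₁ (sub₀ f ∘ g) τ⃗
sub₁-∘ f g (τ ∷ τs) = cong₂ _∷_ (sub₀-∘ f g τ) (trans (sym (map-∘ τs)) (map-cong (sub₀-∘ f g) τs))

sub₂-∘ : ∀ f g σ → sub₂ f (sub₂ g σ) ≡ sub₂ (sub₀ f ∘ g) σ
sub₂-∘ f g (var α) = sub₂-ι f (g α)
sub₂-∘ f g (τ ⊸ σ) = cong₂ _⊸_ (sub₀-∘ f g τ) (sub₂-∘ f g σ)
sub₂-∘ f g (τ ∩ τ⃗ ⇒ σ) = trans
  (cong₂ (λ τ τ⃗ → τ ∩ τ⃗ ⇒ _) (sub₀-∘ f g τ) (sub₁-∘ f g τ⃗))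
  (cong (_ ∩ _ ⇒_) (sub₂-∘ f g σ))

subᵉ-∘ : ∀ f g Γ → subᵉ f (subᵉ g Γ) ≡ subᵉ (sub₀ f ∘ g) Γ
subᵉ-∘ f g Γ = trans (sym (map-∘ Γ)) (map-cong (λ (x , τ⃗) → cong (x ,_) (sub₁-∘ f g τ⃗)) Γ)

-- The syntax-directed system

infix 3 _⊩_∶_

-- The system in syntax-directed form, on multisets of linear declarations:
-- exchange and contraction become admissible.
data _⊩_∶_ : Ctx → Λ → L2 → Set where

  var : ∀ {x τ} → [ x , τ ] ⊩ fvar x ∶ ι τ

  lam : ∀ {Δ x τ⃗ M σ} →
    x ∉ dom Δ →
    block x τ⃗ ++ Δ ⊩ M ∶ σ →
    Δ ⊩ ƛ x M ∶ τ⃗ ⟶ σ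

  app : ∀ {Δ Δs τ⃗ M₁ M₂ σ} →
    Δ ⊩ M₁ ∶ τ⃗ ⟶ σ →
    Pointwise (λ Δᵢ τᵢ → Δᵢ ⊩ M₂ ∶ ι τᵢ) Δs (toList τ⃗) →
    Δ ++ concat Δs ⊩ app M₁ M₂ ∶ σ

  conv : ∀ {Δ Δ′ M σ σ′} →
    Δ ↭ Δ′ → σ ≈₂ σ′ →
    Δ ⊩ M ∶ σ →
    Δ′ ⊩ M ∶ σ′

⊩-resp-↭ : ∀ {Δ Δ′ M σ} → Δ ↭ Δ′ → Δ ⊩ M ∶ σ → Δ′ ⊩ M ∶ σ
⊩-resp-↭ p = conv p (≈₂-refl _)

-- Renaming of term variables

ren : ∀ {n} → (Var → Var) → Term n → Term n
ren ρ (bvar i)  = bvar i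
ren ρ (fvar x)  = fvar (ρ x)
ren ρ (lam M)   = lam (ren ρ M)
ren ρ (app M N) = app (ren ρ M) (ren ρ N)

fv : ∀ {n} → Term n → List Var
fv (bvar i)  = []
fv (fvar x)  = [ x ]
fv (lam M)   = fv M
fv (app M N) = fv M ++ fv N

infixl 8 _[_↦_]
_[_↦_] : {A : Set} → (ℕ → A) → ℕ → A → ℕ → A
(ρ [ x ↦ y ]) z with z ≟ x
... | yes _ = y
... | no  _ = ρ z

↦-≡ : {A : Set} (ρ : ℕ → A) → ∀ x {y} → (ρ [ x ↦ y ]) x ≡ y
↦-≡ ρ x with x ≟ x
... | yes _  = refl
... | no x≢x = contradiction refl x≢x

↦-≢ : {A : Set} (ρ : ℕ → A) → ∀ {x y z} → z ≢ x → (ρ [ x ↦ y ]) z ≡ ρ z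
↦-≢ ρ {x} {_} {z} z≢x with z ≟ x
... | yes z≡x = contradiction z≡x z≢x
... | no _    = refl

subst-var : ∀ {n} (M : Term n) x y → M [ fvar y / x ] ≡ ren (id [ x ↦ y ]) M
subst-var (bvar i)  x y = refl
subst-var (fvar z)  x y with z ≟ x
... | yes _ = refl
... | no _  = refl
subst-var (lam M)   x y = cong lam (subst-var M x y)
subst-var (app M N) x y = cong₂ app (subst-var M x y) (subst-var N x y)

close-fvar : ∀ {n} {x z} → z ≢ x → close {n} x (fvar z) ≡ fvar z
close-fvar {x = x} {z} z≢x with z ≟ x
... | yes z≡x = contradiction z≡x z≢x
... | no _    = refl

ren-close : ∀ {n} ρ x y (M : Term n) → y ∉ map ρ (fv M) →
  ren ρ (close x M) ≡ close y (ren (ρ [ x ↦ y ]) M)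
ren-close ρ x y (bvar i) _ = refl
ren-close ρ x y (fvar z) y∉ with z ≟ x
... | no _ = sym (close-fvar λ ρz≡y → y∉ (here (sym ρz≡y)))
... | yes _ with y ≟ y
...   | yes _  = refl
...   | no y≢y = contradiction refl y≢y
ren-close ρ x y (lam M)   y∉ = cong lam (ren-close ρ x y M y∉)
ren-close ρ x y (app M N) y∉ = cong₂ app
  (ren-close ρ x y M (y∉ ∘ subst (y ∈_) (sym (map-++ ρ (fv M) (fv N))) ∘ ∈-++⁺ˡ))
  (ren-close ρ x y N (y∉ ∘ subst (y ∈_) (sym (map-++ ρ (fv M) (fv N))) ∘ ∈-++⁺ʳ (map ρ (fv M))))

fresh : (xs : List ℕ) → ∃[ x ] x ∉ xs
fresh xs = suc (max 0 xs) , λ x∈ → 1+n≰n (All.lookup (xs≤max 0 xs) x∈)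

renᶜ : (Var → Var) → Ctx → Ctx
renᶜ ρ = map (map₁ ρ)

renᶜ-block : ∀ ρ {x} τs → renᶜ ρ (map (x ,_) τs) ≡ map (ρ x ,_) τs
renᶜ-block ρ τs = sym (map-∘ τs)

renᶜ-↦-∉ : ∀ ρ {x y Δ} → x ∉ dom Δ → renᶜ (ρ [ x ↦ y ]) Δ ≡ renᶜ ρ Δ
renᶜ-↦-∉ ρ x∉ = map-cong-local (All.map (λ {d} z≢x → cong (_, proj₂ d) (↦-≢ ρ z≢x)) (∉⇒≢ x∉))

-- `ρ` may identify variables, as contraction does: a multiset may hold several declarations of one
-- variable, so nothing has to be merged.
⊩-ren : ∀ {Δ M σ} ρ → Δ ⊩ M ∶ σ → renᶜ ρ Δ ⊩ ren ρ M ∶ σ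
⊩s-ren : ∀ {Δs M τs} ρ → Pointwise (λ Δ τ → Δ ⊩ M ∶ ι τ) Δs τs →
  Pointwise (λ Δ τ → Δ ⊩ ren ρ M ∶ ι τ) (map (renᶜ ρ) Δs) τs

⊩-ren ρ var = var
-- The new bound name avoids the renamed names of the body, so that closing captures nothing else,
-- and the renamed context, as `lam` demands.
⊩-ren ρ (lam {Δ} {x} {τ⃗} {M} {σ} x∉ D) with y , y∉ ← fresh (map ρ (fv M) ++ dom (renᶜ ρ Δ)) =
  subst (λ N → renᶜ ρ Δ ⊩ N ∶ τ⃗ ⟶ σ) (cong lam (sym (ren-close ρ x y M (y∉ ∘ ∈-++⁺ˡ))))
    (lam (y∉ ∘ ∈-++⁺ʳ (map ρ (fv M))) (subst (_⊩ ren (ρ [ x ↦ y ]) M ∶ σ) context (⊩-ren (ρ [ x ↦ y ]) D)))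
  where
  context : renᶜ (ρ [ x ↦ y ]) (block x τ⃗ ++ Δ) ≡ block y τ⃗ ++ renᶜ ρ Δ
  context = trans (map-++ _ (block x τ⃗) Δ) (cong₂ _++_
    (trans (renᶜ-block (ρ [ x ↦ y ]) (toList τ⃗)) (cong (λ z → block z τ⃗) (↦-≡ ρ x)))
    (renᶜ-↦-∉ ρ x∉))
⊩-ren ρ (app {Δ} {Δs} {τ⃗} D Ds) = subst (_⊩ _ ∶ _)
  (sym (trans (map-++ _ Δ (concat Δs)) (cong (renᶜ ρ Δ ++_) (sym (concat-map Δs)))))
  (app {τ⃗ = τ⃗} (⊩-ren ρ D) (⊩s-ren ρ Ds))
⊩-ren ρ (conv p q D) = conv (map⁺ _ p) q (⊩-ren ρ D)

⊩s-ren ρ []       = []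
⊩s-ren ρ (D ∷ Ds) = ⊩-ren ρ D ∷ ⊩s-ren ρ Ds

-- From the original system to the syntax-directed one

Consistent-resp-↭ : ∀ {Γ Γ′} → Γ ↭ Γ′ → Consistent Γ → Consistent Γ′
Consistent-resp-↭ p = Permₛ.Unique-resp-↭ (setoid ℕ) (Perm.↭⇒↭ₛ (map⁺ proj₁ p))

flat-↭ : ∀ {Γ Γ′} → Γ ↭ Γ′ → flat Γ ↭ flat Γ′
flat-↭ Perm.refl         = ↭-refl
flat-↭ (Perm.prep (x , τ⃗) p) = ++⁺ˡ (block x τ⃗) (flat-↭ p)
flat-↭ (Perm.swap (x , τ⃗) (y , υ⃗) p) =
  ↭-trans (shifts (block x τ⃗) (block y υ⃗)) (++⁺ˡ (block y υ⃗) (++⁺ˡ (block x τ⃗) (flat-↭ p)))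
flat-↭ (Perm.trans p q)  = ↭-trans (flat-↭ p) (flat-↭ q)

last↭ : (Γ : Env) (d : Decl) → Γ ++ [ d ] ↭ d ∷ Γ
last↭ Γ d = ++-comm Γ [ d ]

exchange↭ : ∀ Γ₁ (d e : Decl) Γ₂ → Γ₁ ++ d ∷ e ∷ Γ₂ ↭ Γ₁ ++ e ∷ d ∷ Γ₂
exchange↭ Γ₁ d e Γ₂ = ++⁺ˡ Γ₁ (Perm.swap _ _ ↭-refl)

≈ᵉ-dom : ∀ {Γ Γ′} → Γ ≈ᵉ Γ′ → dom Γ ≡ dom Γ′
≈ᵉ-dom []               = refl
≈ᵉ-dom ((refl , _) ∷ p) = cong (_ ∷_) (≈ᵉ-dom p)

⊢₂-consistent : ∀ {Γ M σ} → Γ ⊢₂ M ∶ σ → Consistent Γ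
⊢₂-consistent axiom               = [] ∷ []
⊢₂-consistent (exchange {Γ₁} {Γ₂} D) = Consistent-resp-↭ (exchange↭ Γ₁ _ _ Γ₂) (⊢₂-consistent D)
⊢₂-consistent (contraction c _)   = c
⊢₂-consistent (→-intro {Γ} D)     = AllPairs.tail (Consistent-resp-↭ (last↭ Γ _) (⊢₂-consistent D))
⊢₂-consistent (→-elim c _ _)      = c
⊢₂-consistent (⊸-intro {Γ} D)     = AllPairs.tail (Consistent-resp-↭ (last↭ Γ _) (⊢₂-consistent D))
⊢₂-consistent (⊸-elim c _ _)      = c
⊢₂-consistent (conv p _ D)        = subst Unique (≈ᵉ-dom p) (⊢₂-consistent D)

⊩-lam : ∀ {Γ x τ⃗ M σ} → Consistent (Γ ++ [ x ∶ τ⃗ ]) →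
  flat (Γ ++ [ x ∶ τ⃗ ]) ⊩ M ∶ σ → flat Γ ⊩ ƛ x M ∶ τ⃗ ⟶ σ
⊩-lam {Γ} c D = lam (Unique.Unique[x∷xs]⇒x∉xs (Consistent-resp-↭ (last↭ Γ _) c) ∘ flat-dom Γ)
  (⊩-resp-↭ (flat-↭ (last↭ Γ _)) D)

⊩-contraction : ∀ {Δ x x₁ x₂ τ⃗₁ τ⃗₂ M σ} → x₁ ≢ x₂ → x₁ ∉ dom Δ → x₂ ∉ dom Δ →
  block x₁ τ⃗₁ ++ block x₂ τ⃗₂ ++ Δ ⊩ M ∶ σ →
  block x (τ⃗₁ ⁺++⁺ τ⃗₂) ++ Δ ⊩ M [ fvar x / x₁ ] [ fvar x / x₂ ] ∶ σ
⊩-contraction {Δ} {x} {x₁} {x₂} {τ⃗₁} {τ⃗₂} {M} {σ} x₁≢x₂ x₁∉ x₂∉ D =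
  subst₂ (_⊩_∶ σ) context
    (sym (trans (subst-var _ x₂ x) (cong (ren ρ₂) (subst-var M x₁ x))))
    (⊩-ren ρ₂ (⊩-ren ρ₁ D))
  where
  open ≡-Reasoning
  ρ₁ = id [ x₁ ↦ x ]
  ρ₂ = id [ x₂ ↦ x ]
  -- Contraction may reuse `x₂` as the name `x`; in that case, too, the second renaming leaves `x`
  -- alone.
  ρ₂x : ρ₂ x ≡ x
  ρ₂x with x ≟ x₂
  ... | yes _ = refl
  ... | no _  = refl
  unchanged : ∀ {y} → y ∉ dom Δ → renᶜ (id [ y ↦ x ]) Δ ≡ Δ
  unchanged y∉ = trans (renᶜ-↦-∉ id y∉) (map-id Δ)
  ren-++ : ∀ ρ y z Δ →
    renᶜ ρ (block y τ⃗₁ ++ block z τ⃗₂ ++ Δ) ≡ block (ρ y) τ⃗₁ ++ block (ρ z) τ⃗₂ ++ renᶜ ρ Δ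
  ren-++ ρ y z Δ = trans (map-++ _ (block y τ⃗₁) _) (cong₂ _++_ (renᶜ-block ρ (toList τ⃗₁))
    (trans (map-++ _ (block z τ⃗₂) _) (cong (_++ renᶜ ρ Δ) (renᶜ-block ρ (toList τ⃗₂)))))
  context : renᶜ ρ₂ (renᶜ ρ₁ (block x₁ τ⃗₁ ++ block x₂ τ⃗₂ ++ Δ)) ≡ block x (τ⃗₁ ⁺++⁺ τ⃗₂) ++ Δ
  context = begin
    renᶜ ρ₂ (renᶜ ρ₁ (block x₁ τ⃗₁ ++ block x₂ τ⃗₂ ++ Δ))
      ≡⟨ cong (renᶜ ρ₂) (ren-++ ρ₁ x₁ x₂ Δ) ⟩
    renᶜ ρ₂ (block (ρ₁ x₁) τ⃗₁ ++ block (ρ₁ x₂) τ⃗₂ ++ renᶜ ρ₁ Δ)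
      ≡⟨ ren-++ ρ₂ (ρ₁ x₁) (ρ₁ x₂) (renᶜ ρ₁ Δ) ⟩
    block (ρ₂ (ρ₁ x₁)) τ⃗₁ ++ block (ρ₂ (ρ₁ x₂)) τ⃗₂ ++ renᶜ ρ₂ (renᶜ ρ₁ Δ)
      ≡⟨ cong₂ (λ y z → block y τ⃗₁ ++ block z τ⃗₂ ++ renᶜ ρ₂ (renᶜ ρ₁ Δ))
           (trans (cong ρ₂ (↦-≡ id x₁)) ρ₂x)
           (trans (cong ρ₂ (↦-≢ id (x₁≢x₂ ∘ sym))) (↦-≡ id x₂)) ⟩
    block x τ⃗₁ ++ block x τ⃗₂ ++ renᶜ ρ₂ (renᶜ ρ₁ Δ)
      ≡⟨ cong (λ Δ′ → block x τ⃗₁ ++ block x τ⃗₂ ++ Δ′)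
           (trans (cong (renᶜ ρ₂) (unchanged x₁∉)) (unchanged x₂∉)) ⟩
    block x τ⃗₁ ++ block x τ⃗₂ ++ Δ
      ≡⟨ ++-assoc (block x τ⃗₁) _ _ ⟨
    (block x τ⃗₁ ++ block x τ⃗₂) ++ Δ
      ≡⟨ cong (_++ Δ) (map-++ (x ,_) (toList τ⃗₁) (toList τ⃗₂)) ⟨
    block x (τ⃗₁ ⁺++⁺ τ⃗₂) ++ Δ ∎

⊢₂⇒⊩ : ∀ {Γ M σ} → Γ ⊢₂ M ∶ σ → flat Γ ⊩ M ∶ σ
⊢₂s⇒⊩s : ∀ {Γs M τs} → Pointwise (λ Γ τ → Γ ⊢₂ M ∶ ι τ) Γs τs →
  Pointwise (λ Δ τ → Δ ⊩ M ∶ ι τ) (map flat Γs) τs × All Consistent Γs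

⊢₂⇒⊩ axiom = var
⊢₂⇒⊩ (exchange {Γ₁} {Γ₂} {x} {y} {τ⃗₁} {τ⃗₂} D) =
  ⊩-resp-↭ (flat-↭ (exchange↭ Γ₁ (x ∶ τ⃗₁) (y ∶ τ⃗₂) Γ₂)) (⊢₂⇒⊩ D)
⊢₂⇒⊩ (contraction {Γ₁} {Γ₂} {x} {x₁} {x₂} {τ⃗₁} {τ⃗₂} _ D) =
  ⊩-resp-↭ (flat-↭ (↭-sym (shift (x ∶ τ⃗₁ ⁺++⁺ τ⃗₂) Γ₁ Γ₂)))
    (⊩-contraction {flat (Γ₁ ++ Γ₂)} {x} {x₁} {x₂} {τ⃗₁} {τ⃗₂}
      (λ x₁≡x₂ → Unique.Unique[x∷xs]⇒x∉xs c (here x₁≡x₂))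
      (Unique.Unique[x∷xs]⇒x∉xs c ∘ there ∘ flat-dom (Γ₁ ++ Γ₂))
      (Unique.Unique[x∷xs]⇒x∉xs (AllPairs.tail c) ∘ flat-dom (Γ₁ ++ Γ₂))
      (⊩-resp-↭ (flat-↭ reorder) (⊢₂⇒⊩ D)))
  where
  reorder : Γ₁ ++ (x₁ ∶ τ⃗₁) ∷ (x₂ ∶ τ⃗₂) ∷ Γ₂ ↭ (x₁ ∶ τ⃗₁) ∷ (x₂ ∶ τ⃗₂) ∷ Γ₁ ++ Γ₂
  reorder = ↭-trans (shift _ Γ₁ _) (↭-prep _ (shift _ Γ₁ _))
  c : Consistent ((x₁ ∶ τ⃗₁) ∷ (x₂ ∶ τ⃗₂) ∷ Γ₁ ++ Γ₂)
  c = Consistent-resp-↭ reorder (⊢₂-consistent D)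
⊢₂⇒⊩ (→-intro {τ = τ} {τ⃗@(_ ∷ _)} D) = ⊩-lam {τ⃗ = τ ∷⁺ τ⃗} (⊢₂-consistent D) (⊢₂⇒⊩ D)
⊢₂⇒⊩ (→-elim {Γ} {Γs} {τ} {τ⃗@(_ ∷ _)} _ D Ds) with Ds′ , cs ← ⊢₂s⇒⊩s Ds =
  ⊩-resp-↭ (↭-trans (++⁺ˡ (flat Γ) (↭-sym (flat-∑ cs))) (↭-reflexive (sym (flat-++ Γ (∑ Γs)))))
    (app {τ⃗ = τ ∷⁺ τ⃗} (⊢₂⇒⊩ D) Ds′)
⊢₂⇒⊩ (⊸-intro {τ = τ} D) = ⊩-lam {τ⃗ = τ ∷ []} (⊢₂-consistent D) (⊢₂⇒⊩ D)
⊢₂⇒⊩ (⊸-elim {Γ₁} {Γ₂} {τ} _ D₁ D₂) =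
  ⊩-resp-↭ (↭-reflexive (trans (cong (flat Γ₁ ++_) (++-identityʳ _)) (sym (flat-++ Γ₁ Γ₂))))
    (app {τ⃗ = τ ∷ []} (⊢₂⇒⊩ D₁) (⊢₂⇒⊩ D₂ ∷ []))
⊢₂⇒⊩ (conv p q D) = conv (flat-≈ᵉ p) q (⊢₂⇒⊩ D)

⊢₂s⇒⊩s []       = [] , []
⊢₂s⇒⊩s (D ∷ Ds) with Ds′ , cs ← ⊢₂s⇒⊩s Ds = ⊢₂⇒⊩ D ∷ Ds′ , ⊢₂-consistent D ∷ cs

-- Disjoint copies of type variables

-- Type variables are renamed apart by sending those of one result to the
-- even numbers and those of the others to the odd ones.
even odd : ℕ → ℕ
even zero    = zero
even (suc n) = suc (suc (even n))
odd n = suc (even n)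

join : {A : Set} → (ℕ → A) → (ℕ → A) → ℕ → A
join f g zero          = f zero
join f g (suc zero)    = g zero
join f g (suc (suc n)) = join (f ∘ suc) (g ∘ suc) n

join-even : {A : Set} (f g : ℕ → A) → ∀ n → join f g (even n) ≡ f n
join-even f g zero    = refl
join-even f g (suc n) = join-even (f ∘ suc) (g ∘ suc) n

join-odd : {A : Set} (f g : ℕ → A) → ∀ n → join f g (odd n) ≡ g n
join-odd f g zero    = refl
join-odd f g (suc n) = join-odd (f ∘ suc) (g ∘ suc) n

even-injective : Injective _≡_ _≡_ even
even-injective {m} {n} eq = trans (sym (join-even id id m)) (trans (cong (join id id) eq) (join-even id id n))

odd-injective : Injective _≡_ _≡_ odd
odd-injective {m} {n} eq = trans (sym (join-odd id id m)) (trans (cong (join id id) eq) (join-odd id id n))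

even≢odd : ∀ m n → even m ≢ odd n
even≢odd m n eq with () ← trans (sym (join-even (λ _ → 0) (λ _ → 1) m))
  (trans (cong (join (λ _ → 0) (λ _ → 1)) eq) (join-odd (λ _ → 0) (λ _ → 1) n))

Disjoint-map : ∀ {ρ : ℕ → ℕ} {xs ys} → Injective _≡_ _≡_ ρ → Disjoint xs ys → Disjoint (map ρ xs) (map ρ ys)
Disjoint-map {ρ} inj d (p , q) with a , a∈ , refl ← ∈-map⁻ ρ p | b , b∈ , eq ← ∈-map⁻ ρ q
  with refl ← inj eq = d (a∈ , b∈)

even-odd-apart : ∀ {xs xss} → AllPairs Disjoint xss → AllPairs Disjoint (map even xs ∷ map (map odd) xss)
even-odd-apart {xs} {xss} d =
  All.map⁺ (All.universal (λ ys {_} → separate ys) xss) ∷ 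
  AllPairs.map⁺ (AllPairs.map {R = Disjoint} (λ d {_} → Disjoint-map odd-injective (λ {_} → d)) d)
  where
  separate : ∀ ys → Disjoint (map even xs) (map odd ys)
  separate ys (p , q) with a , _ , refl ← ∈-map⁻ even p | b , _ , eq ← ∈-map⁻ odd q = even≢odd a b eq

tv₀-ren : ∀ ρ τ → tv₀ (sub₀ (var ∘ ρ) τ) ≡ map ρ (tv₀ τ)
tv₀-ren ρ (var α) = refl
tv₀-ren ρ (τ ⊸ υ) = trans (cong₂ _++_ (tv₀-ren ρ τ) (tv₀-ren ρ υ)) (sym (map-++ ρ (tv₀ τ) (tv₀ υ)))

tv₁-ren : ∀ ρ τ⃗ → tv₁ (sub₁ (var ∘ ρ) τ⃗) ≡ map ρ (tv₁ τ⃗)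
tv₁-ren ρ (τ ∷ τs) = trans (concatMap-map tv₀ (sub₀ (var ∘ ρ)) (τ ∷ τs))
  (trans (concatMap-cong (tv₀-ren ρ) (τ ∷ τs)) (sym (map-concatMap ρ tv₀ (τ ∷ τs))))

tv₂-ren : ∀ ρ σ → tv₂ (sub₂ (var ∘ ρ) σ) ≡ map ρ (tv₂ σ)
tv₂-ren ρ (var α) = refl
tv₂-ren ρ (τ ⊸ σ) = trans (cong₂ _++_ (tv₀-ren ρ τ) (tv₂-ren ρ σ)) (sym (map-++ ρ (tv₀ τ) (tv₂ σ)))
tv₂-ren ρ (τ ∩ τ⃗ ⇒ σ) = trans
  (cong₂ _++_ (tv₀-ren ρ τ) (trans (cong₂ _++_ (tv₁-ren ρ τ⃗) (tv₂-ren ρ σ)) (sym (map-++ ρ (tv₁ τ⃗) (tv₂ σ)))))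
  (sym (map-++ ρ (tv₀ τ) (tv₁ τ⃗ ++ tv₂ σ)))

tvᵉ-ren : ∀ ρ Γ → tvᵉ (subᵉ (var ∘ ρ) Γ) ≡ map ρ (tvᵉ Γ)
tvᵉ-ren ρ Γ = trans (concatMap-map (tv₁ ∘ proj₂) (map₂ (sub₁ (var ∘ ρ))) Γ)
  (trans (concatMap-cong (tv₁-ren ρ ∘ proj₂) Γ) (sym (map-concatMap ρ (tv₁ ∘ proj₂) Γ)))

tvᴿ-ren : ∀ ρ Γ σ → tvᴿ (subᵉ (var ∘ ρ) Γ) (sub₂ (var ∘ ρ) σ) ≡ map ρ (tvᴿ Γ σ)
tvᴿ-ren ρ Γ σ = trans (cong₂ _++_ (tvᵉ-ren ρ Γ) (tv₂-ren ρ σ)) (sym (map-++ ρ (tvᵉ Γ) (tv₂ σ)))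

-- Instances of environments, and the rules of `T` for general arrows

subᶜ : (TVar → L0) → Ctx → Ctx
subᶜ f = map (map₂ (sub₀ f))

flat-sub : ∀ f Γ → flat (subᵉ f Γ) ≡ subᶜ f (flat Γ)
flat-sub f [] = refl
flat-sub f ((x , (τ ∷ τs)) ∷ Γ) = trans
  (cong₂ _++_ (trans (sym (map-∘ (τ ∷ τs))) (map-∘ (τ ∷ τs))) (flat-sub f Γ))
  (sym (map-++ _ (block x (τ ∷ τs)) (flat Γ)))

sub-consistent : ∀ {f Γ} → Consistent Γ → Consistent (subᵉ f Γ)
sub-consistent {f} {Γ} = subst Unique (map-∘ Γ)

sub-without : ∀ f x Γ → subᵉ f Γ ∖ x ≡ subᵉ f (Γ ∖ x)
sub-without f x [] = refl
sub-without f x ((y , τ⃗) ∷ Γ) = by-cases (y ≟ x)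
  where
  by-cases : Dec (y ≡ x) → subᵉ f ((y , τ⃗) ∷ Γ) ∖ x ≡ subᵉ f (((y , τ⃗) ∷ Γ) ∖ x)
  by-cases (yes y≡x) = trans (filter-reject (λ d → ¬? (proj₁ d ≟ x)) λ y≢x → y≢x y≡x)
    (trans (sub-without f x Γ) (cong (subᵉ f) (sym (filter-reject (λ d → ¬? (proj₁ d ≟ x)) λ y≢x → y≢x y≡x))))
  by-cases (no y≢x) = trans (filter-accept (λ d → ¬? (proj₁ d ≟ x)) y≢x)
    (trans (cong (_ ∷_) (sub-without f x Γ)) (cong (subᵉ f) (sym (filter-accept (λ d → ¬? (proj₁ d ≟ x)) y≢x))))

flat-sub-⊞ : ∀ f Γ Γs → Consistent Γ → All Consistent Γs →
  flat (subᵉ f (Γ ⊞ ∑ Γs)) ↭ flat (subᵉ f Γ) ++ concatMap (flat ∘ subᵉ f) Γs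
flat-sub-⊞ f Γ Γs c cs = begin
  flat (subᵉ f (Γ ⊞ ∑ Γs))                          ≡⟨ flat-sub f (Γ ⊞ ∑ Γs) ⟩
  subᶜ f (flat (Γ ⊞ ∑ Γs))                          ↭⟨ map⁺ _ (flat-⊞ Γ (∑ Γs) c (∑-consistent cs)) ⟩
  subᶜ f (flat Γ ++ flat (∑ Γs))                    ↭⟨ map⁺ _ (++⁺ˡ (flat Γ) (flat-∑ cs)) ⟩
  subᶜ f (flat Γ ++ concatMap flat Γs)              ≡⟨ map-++ _ (flat Γ) _ ⟩
  subᶜ f (flat Γ) ++ subᶜ f (concatMap flat Γs)    
    ≡⟨ cong₂ _++_ (flat-sub f Γ)
         (trans (concatMap-cong (flat-sub f) Γs) (sym (map-concatMap _ flat Γs))) ⟨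
  flat (subᵉ f Γ) ++ concatMap (flat ∘ subᵉ f) Γs   ∎
  where open PermutationReasoning

⊞-[] : ∀ Γ → Γ ⊞ [] ≡ Γ
⊞-[] Γ = trans (++-identityʳ _) (map-id Γ)

tvᴬ : Env × L0 → List TVar
tvᴬ (Γ , υ) = tvᴿ Γ (ι υ)

T-lam : ∀ {M Γ σ x} τ⃗ → T M Γ σ → (x , τ⃗) ∈ Γ → T (ƛ x M) (Γ ∖ x) (τ⃗ ⟶ σ)
T-lam (_ ∷ [])    = T-lam⊸
T-lam (_ ∷ _ ∷ _) = T-lam→

-- Joins `T-app⊸` and `T-app→`, so that applications need no distinction by the length of the
-- sequence. For length one the sum ends in `⊞ []`, which has to be removed.
T-app : ∀ {M₁ M₂ Γ σ Rs S} τ⃗ → T M₁ Γ (τ⃗ ⟶ σ) → All (λ (Γ , υ) → T M₂ Γ (ι υ)) Rs →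
  length Rs ≡ length (toList τ⃗) → AllPairs Disjoint (tvᴿ Γ (τ⃗ ⟶ σ) ∷ map tvᴬ Rs) →
  Unify (zip (map proj₂ Rs) (toList τ⃗)) S →
  T (app M₁ M₂) (subᵉ ⟦ S ⟧ (Γ ⊞ ∑ (map proj₁ Rs))) (sub₂ ⟦ S ⟧ σ)
T-app {Γ = Γ} {σ} {S = S} (τ ∷ []) t (_∷_ {Γ₂ , _} t′ []) _ ((d ∷ []) ∷ _) U =
  subst (λ Γ′ → T _ (subᵉ ⟦ S ⟧ (Γ ⊞ Γ′)) (sub₂ ⟦ S ⟧ σ)) (sym (⊞-[] Γ₂)) (T-app⊸ {S = S} t t′ d U)
T-app {M₂ = M₂} {Rs = Rs} {S} (_ ∷ _ ∷ _) t ts len d U = T-app→ {S = S} t (pointwise ts)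
  (trans (length-map proj₂ Rs) len) (subst (λ vss → AllPairs Disjoint (_ ∷ vss)) (zipped Rs) d) U
  where
  pointwise : ∀ {Rs} → All (λ (Γ , υ) → T M₂ Γ (ι υ)) Rs →
    Pointwise (λ Γ υ → T M₂ Γ (ι υ)) (map proj₁ Rs) (map proj₂ Rs)
  pointwise []       = []
  pointwise (t ∷ ts) = t ∷ pointwise ts
  zipped : ∀ Rs → map tvᴬ Rs ≡ zipWith (λ Γ υ → tvᴿ Γ (ι υ)) (map proj₁ Rs) (map proj₂ Rs)
  zipped []       = refl
  zipped (R ∷ Rs) = cong (_ ∷_) (zipped Rs)

-- Completeness of inference

-- The induction invariant. The context is compared after flattening, and `f` is exposed as a
-- parameter so that results for several subterms can be made to share it.
record Generalizes (f : TVar → L0) (M : Λ) (Δ : Ctx) (σ : L2) (Γ : Env) (σ′ : L2) : Set where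
  field
    consistent : Consistent Γ
    inferred   : T M Γ σ′
    type       : sub₂ f σ′ ≈₂ σ
    context    : flat (subᵉ f Γ) ↭ Δ

open Generalizes

Infers : Λ → Ctx → L2 → Set
Infers M Δ σ = ∃[ Γ ] ∃[ σ′ ] ∃[ f ] Generalizes f M Δ σ Γ σ′

Generalizes-ren : ∀ {f g ρ M Δ σ Γ σ′} → Injective _≡_ _≡_ ρ → (∀ α → g (ρ α) ≡ f α) →
  Generalizes f M Δ σ Γ σ′ → Generalizes g M Δ σ (subᵉ (var ∘ ρ) Γ) (sub₂ (var ∘ ρ) σ′)
Generalizes-ren {f} {g} {ρ} {Γ = Γ} {σ′} inj gρ G = record
  { consistent = sub-consistent (consistent G)
  ; inferred   = rename inj (inferred G)
  ; type       = ≈₂-trans (≈₂-reflexive (trans (sub₂-∘ g _ σ′) (sub₂-cong σ′ λ {α} _ → gρ α))) (type G)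
  ; context    = ↭-trans (↭-reflexive (cong flat (trans (subᵉ-∘ g _ Γ) (subᵉ-cong Γ λ {α} _ → gρ α)))) (context G)
  }

-- Results for the argument of an application, one for each type it is used at.
data Family (f : TVar → L0) (M : Λ) : List Ctx → List L0 → List (Env × L0) → Set where
  []  : Family f M [] [] []
  _∷_ : ∀ {Δ τ Γ υ Δs τs Rs} → Generalizes f M Δ (ι τ) Γ (ι υ) → Family f M Δs τs Rs →
        Family f M (Δ ∷ Δs) (τ ∷ τs) ((Γ , υ) ∷ Rs)

renᴬ : (TVar → TVar) → Env × L0 → Env × L0
renᴬ ρ (Γ , υ) = subᵉ (var ∘ ρ) Γ , sub₀ (var ∘ ρ) υ

Family-ren : ∀ {f g ρ M Δs τs Rs} → Injective _≡_ _≡_ ρ → (∀ α → g (ρ α) ≡ f α) →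
  Family f M Δs τs Rs → Family g M Δs τs (map (renᴬ ρ) Rs)
Family-ren inj gρ [] = []
Family-ren {ρ = ρ} inj gρ (_∷_ {υ = υ} G F) =
  subst (Generalizes _ _ _ _ _) (sub₂-ι (var ∘ ρ) υ) (Generalizes-ren inj gρ G) ∷ Family-ren inj gρ F

tvᴬ-ren : ∀ ρ R → tvᴬ (renᴬ ρ R) ≡ map ρ (tvᴬ R)
tvᴬ-ren ρ (Γ , υ) = trans (cong (tvᴿ (subᵉ (var ∘ ρ) Γ)) (sym (sub₂-ι (var ∘ ρ) υ))) (tvᴿ-ren ρ Γ (ι υ))

tvᴬs-ren : ∀ ρ Rs → map tvᴬ (map (renᴬ ρ) Rs) ≡ map (map ρ) (map tvᴬ Rs)
tvᴬs-ren ρ Rs = trans (sym (map-∘ Rs)) (trans (map-cong (tvᴬ-ren ρ) Rs) (map-∘ Rs))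

family : ∀ {M Δs τs} → Pointwise (λ Δ τ → Infers M Δ (ι τ)) Δs τs →
  ∃[ f ] ∃[ Rs ] (Family f M Δs τs Rs × AllPairs Disjoint (map tvᴬ Rs))
family [] = var , [] , [] , []
family (_∷_ {y = τ} (Γ , σ , f , G) Is)
  with g , Rs , F , d ← family Is | υ , refl , _ ← sub₂-ι⁻ f σ τ (type G)
  with G′ ∷ [] ← Family-ren {g = join f g} even-injective (join-even f g) (G ∷ [])
  = join f g , _ , G′ ∷ Family-ren odd-injective (join-odd f g) F
  , subst (AllPairs Disjoint) (sym (cong₂ _∷_ (tvᴬ-ren even (Γ , υ)) (tvᴬs-ren odd Rs))) (even-odd-apart d)

module _ {f : TVar → L0} {M : Λ} where

  Family-inferred : ∀ {Δs τs Rs} → Family f M Δs τs Rs → All (λ (Γ , υ) → T M Γ (ι υ)) Rs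
  Family-inferred []      = []
  Family-inferred (G ∷ F) = inferred G ∷ Family-inferred F

  Family-consistent : ∀ {Δs τs Rs} → Family f M Δs τs Rs → All Consistent (map proj₁ Rs)
  Family-consistent []      = []
  Family-consistent (G ∷ F) = consistent G ∷ Family-consistent F

  Family-types : ∀ {Δs τs Rs} → Family f M Δs τs Rs → map (sub₀ f) (map proj₂ Rs) ≡ τs
  Family-types []                  = refl
  Family-types (_∷_ {υ = υ} G F) =
    cong₂ _∷_ (ι-injective (≈₂-trans (≈₂-reflexive (sym (sub₂-ι f υ))) (type G))) (Family-types F)

  Family-contexts : ∀ {Δs τs Rs} → Family f M Δs τs Rs →
    concatMap (flat ∘ subᵉ f) (map proj₁ Rs) ↭ concat Δs
  Family-contexts []      = ↭-refl
  Family-contexts (G ∷ F) = ++⁺ (context G) (Family-contexts F)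

unifies-zip : ∀ {f} ls rs → map (sub₀ f) ls ≡ map (sub₀ f) rs → Unifies f (zip ls rs)
unifies-zip []       _        _  = []
unifies-zip (_ ∷ _)  []       _  = []
unifies-zip (l ∷ ls) (r ∷ rs) eq with p , q ← ∷-injective eq = p ∷ unifies-zip ls rs q

module _ {f S} (sol : Solves f (bindings S)) where

  sub₂-absorb : ∀ σ → sub₂ f (sub₂ ⟦ S ⟧ σ) ≡ sub₂ f σ
  sub₂-absorb σ = trans (sub₂-∘ f ⟦ S ⟧ σ) (sub₂-cong σ λ {α} _ → solves⇒absorbs S sol α)

  subᵉ-absorb : ∀ Γ → subᵉ f (subᵉ ⟦ S ⟧ Γ) ≡ subᵉ f Γ
  subᵉ-absorb Γ = trans (subᵉ-∘ f ⟦ S ⟧ Γ) (subᵉ-cong Γ λ {α} _ → solves⇒absorbs S sol α)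

-- The arguments are used at the `f`-instances of the inferred domain `υ⃗`, in the order of `υ⃗`, so
-- `f` solves the equations position by position.
infer-app-⟶ : ∀ {f M₁ M₂ Δ Δs Γ τ⃗ υ⃗ σ ρ Rs} →
  Generalizes f M₁ Δ (τ⃗ ⟶ σ) Γ (υ⃗ ⟶ ρ) → sub₂ f ρ ≈₂ σ →
  Family f M₂ Δs (map (sub₀ f) (toList υ⃗)) Rs →
  AllPairs Disjoint (tvᴿ Γ (υ⃗ ⟶ ρ) ∷ map tvᴬ Rs) →
  Infers (app M₁ M₂) (Δ ++ concat Δs) σ
infer-app-⟶ {f} {Γ = Γ} {υ⃗ = υ⃗} {ρ = ρ} {Rs} G ρ≈σ F d
  with S , U , sol ← mgu {f} (zip (map proj₂ Rs) (toList υ⃗))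
                       (unifies-zip (map proj₂ Rs) (toList υ⃗) (Family-types F))
  = _ , _ , f , record
  { consistent = sub-consistent (⊞-consistent (consistent G) (∑-consistent (Family-consistent F)))
  ; inferred   = T-app {S = S} υ⃗ (inferred G) (Family-inferred F) len d U
  ; type       = ≈₂-trans (≈₂-reflexive (sub₂-absorb {S = S} sol ρ)) ρ≈σ
  ; context    = ↭-trans (↭-reflexive (cong flat (subᵉ-absorb {S = S} sol (Γ ⊞ ∑ (map proj₁ Rs)))))
      (↭-trans (flat-sub-⊞ f Γ (map proj₁ Rs) (consistent G) (Family-consistent F))
        (++⁺ (context G) (Family-contexts F)))
  }
  where
  len : length Rs ≡ length (toList υ⃗)
  len = trans (sym (trans (length-map (sub₀ f) (map proj₂ Rs)) (length-map proj₂ Rs)))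
    (trans (cong length (Family-types F)) (length-map (sub₀ f) (toList υ⃗)))

Generalizes-cong : ∀ {f g M Δ σ Γ σ′} → (∀ {α} → α ∈ tvᴿ Γ σ′ → g α ≡ f α) →
  Generalizes f M Δ σ Γ σ′ → Generalizes g M Δ σ Γ σ′
Generalizes-cong {Γ = Γ} {σ′} g≗f G = record
  { consistent = consistent G
  ; inferred   = inferred G
  ; type       = ≈₂-trans (≈₂-reflexive (sub₂-cong σ′ (g≗f ∘ ∈-++⁺ʳ (tvᵉ Γ)))) (type G)
  ; context    = ↭-trans (↭-reflexive (cong flat (subᵉ-cong Γ (g≗f ∘ ∈-++⁺ˡ)))) (context G)
  }

infer-app-var : ∀ {f M₁ M₂ Δ₁ Δ₂ Γ₁ Γ₂ α τ υ τ₂} →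
  Generalizes f M₁ Δ₁ (τ ⊸ ι υ) Γ₁ (var α) → Generalizes f M₂ Δ₂ (ι τ) Γ₂ (ι τ₂) →
  Disjoint (tvᴿ Γ₁ (var α)) (tvᴿ Γ₂ (ι τ₂)) →
  Infers (app M₁ M₂) (Δ₁ ++ Δ₂) (ι υ)
infer-app-var {f} {Γ₁ = Γ₁} {Γ₂} {α} {τ} {υ} {τ₂} G₁ G₂ d
  with α₂ , α₂∉ ← fresh (tvᴿ Γ₁ (var α) ++ tvᴿ Γ₂ (ι τ₂))
  with α₃ , α₃∉ ← fresh (α₂ ∷ tvᴿ Γ₁ (var α) ++ tvᴿ Γ₂ (ι τ₂))
  = result (mgu P (function ∷ arg ∷ []))
  where
  -- The unifier must also value the two new variables: they receive the domain and codomain of the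
  -- instance of `α`. Being fresh, they occur in neither result, so both keep their instances.
  g = f [ α₂ ↦ τ ] [ α₃ ↦ υ ]
  P = (var α , var α₂ ⊸ var α₃) ∷ (τ₂ , var α₂) ∷ []
  g≗f : ∀ {β} → β ∈ tvᴿ Γ₁ (var α) ++ tvᴿ Γ₂ (ι τ₂) → g β ≡ f β
  g≗f {β} β∈ = trans
    (↦-≢ (f [ α₂ ↦ τ ]) {α₃} {υ} {β} λ { refl → α₃∉ (there β∈) })
    (↦-≢ f {α₂} {τ} {β} λ { refl → α₂∉ β∈ })
  g-α₂ : g α₂ ≡ τ
  g-α₂ = trans (↦-≢ (f [ α₂ ↦ τ ]) {α₃} {υ} {α₂} λ { refl → α₃∉ (here refl) }) (↦-≡ f α₂)
  g-α₃ : g α₃ ≡ υ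
  g-α₃ = ↦-≡ (f [ α₂ ↦ τ ]) α₃
  H₁ = Generalizes-cong {g = g} (g≗f ∘ ∈-++⁺ˡ) G₁
  H₂ = Generalizes-cong {g = g} (g≗f ∘ ∈-++⁺ʳ (tvᴿ Γ₁ (var α))) G₂
  function : g α ≡ g α₂ ⊸ g α₃
  function = trans (ι-injective {υ = τ ⊸ υ} (type H₁)) (sym (cong₂ _⊸_ g-α₂ g-α₃))
  arg : sub₀ g τ₂ ≡ g α₂
  arg = trans (ι-injective (≈₂-trans (≈₂-reflexive (sym (sub₂-ι g τ₂))) (type H₂))) (sym g-α₂)
  result : MGU g P → Infers _ _ _
  result (S , U , sol) = _ , _ , g , record
    { consistent = sub-consistent (⊞-consistent (consistent H₁) (consistent H₂))
    ; inferred   = T-app-var {S = S} (inferred H₁) (inferred H₂) d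
        α₂∉ (α₃∉ ∘ there) (λ { refl → α₃∉ (here refl) }) U
    ; type       = ≈₂-reflexive (trans (sub₂-absorb {S = S} sol (var α₃)) (cong ι g-α₃))
    ; context    = ↭-trans (↭-reflexive (cong flat (subᵉ-absorb {S = S} sol (Γ₁ ⊞ Γ₂))))
        (↭-trans (↭-reflexive (cong (λ Γ → flat (subᵉ g (Γ₁ ⊞ Γ))) (sym (⊞-[] Γ₂))))
          (↭-trans (flat-sub-⊞ g Γ₁ [ Γ₂ ] (consistent H₁) (consistent H₂ ∷ []))
            (++⁺ (context H₁) (↭-trans (↭-reflexive (++-identityʳ _)) (context H₂)))))
    }

-- A type with an arrow as instance is a variable or already an arrow. Variables have linear
-- instances, which forces a sequence of length one. The two cases select the application rule of
-- `T`.
sub₂-⟶⁻ : ∀ f σ′ τ⃗ {σ} → sub₂ f σ′ ≈₂ (τ⃗ ⟶ σ) →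
  (∃[ α ] ∃[ τ ] ∃[ υ ] (σ′ ≡ var α × τ⃗ ≡ τ ∷ [] × ι υ ≈₂ σ)) ⊎
  (∃[ υ⃗ ] ∃[ ρ ] (σ′ ≡ υ⃗ ⟶ ρ × sub₁ f υ⃗ ≈₁ τ⃗ × sub₂ f ρ ≈₂ σ))
sub₂-⟶⁻ f (var α) (τ ∷ []) p with f α
sub₂-⟶⁻ f (var α) (τ ∷ []) (_ ⊸ p) | _ ⊸ υ = inj₁ (α , τ , υ , refl , refl , p)
sub₂-⟶⁻ f (var α) (_ ∷ _ ∷ _) p with f α
sub₂-⟶⁻ f (var α) (_ ∷ _ ∷ _) () | var _
sub₂-⟶⁻ f (var α) (_ ∷ _ ∷ _) () | _ ⊸ _
sub₂-⟶⁻ f (τ ⊸ ρ) (_ ∷ []) (_ ⊸ p) = inj₂ (τ ∷ [] , ρ , refl , ↭-refl , p)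
sub₂-⟶⁻ f (τ ∩ υ ∷ υs ⇒ ρ) (_ ∷ _ ∷ _) (q ⇒ p) = inj₂ (τ ∷ υ ∷ υs , ρ , refl , q , p)

Pointwise-↭ : {A B : Set} {R : A → B → Set} {xs : List A} {ys zs : List B} →
  Pointwise R xs ys → ys ↭ zs → ∃[ ws ] (xs ↭ ws × Pointwise R ws zs)
Pointwise-↭ rs Perm.refl = _ , ↭-refl , rs
Pointwise-↭ (r ∷ rs) (Perm.prep _ p) with ws , q , rs′ ← Pointwise-↭ rs p = _ , ↭-prep _ q , r ∷ rs′
Pointwise-↭ (r ∷ r′ ∷ rs) (Perm.swap _ _ p) with ws , q , rs′ ← Pointwise-↭ rs p =
  _ , Perm.swap _ _ q , r′ ∷ r ∷ rs′
Pointwise-↭ rs (Perm.trans p p′) with ws , q , rs′ ← Pointwise-↭ rs p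
  with ws′ , q′ , rs″ ← Pointwise-↭ rs′ p′ = ws′ , ↭-trans q q′ , rs″

concat-↭ : {Δs Δs′ : List Ctx} → Δs ↭ Δs′ → concat Δs ↭ concat Δs′
concat-↭ Perm.refl = ↭-refl
concat-↭ (Perm.prep Δ p) = ++⁺ˡ Δ (concat-↭ p)
concat-↭ (Perm.swap Δ Δ′ p) = ↭-trans (shifts Δ Δ′) (++⁺ˡ Δ′ (++⁺ˡ Δ (concat-↭ p)))
concat-↭ (Perm.trans p q) = ↭-trans (concat-↭ p) (concat-↭ q)

Infers-resp : ∀ {M Δ Δ′ σ σ′} → Δ ↭ Δ′ → σ ≈₂ σ′ → Infers M Δ σ → Infers M Δ′ σ′
Infers-resp p q (Γ , σ , f , G) = Γ , σ , f , record
  { consistent = consistent G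
  ; inferred   = inferred G
  ; type       = ≈₂-trans (type G) q
  ; context    = ↭-trans (context G) p
  }

infer-app : ∀ {M₁ M₂ Δ Δs σ} τ⃗ → Infers M₁ Δ (τ⃗ ⟶ σ) →
  Pointwise (λ Δᵢ τᵢ → Infers M₂ Δᵢ (ι τᵢ)) Δs (toList τ⃗) →
  Infers (app M₁ M₂) (Δ ++ concat Δs) σ
infer-app {M₁} {M₂} {Δ = Δ} {Δs} {σ} τ⃗ (Γ , σ′ , f , G) Is with sub₂-⟶⁻ f σ′ τ⃗ (type G)
infer-app {M₁} {M₂} {Δ = Δ} {Δ₂ ∷ []} {σ} τ⃗ (Γ , σ′ , f , G) Is@(_ ∷ [])
  | inj₁ (α , τ , υ , refl , refl , υ≈σ)
  with g , _ , F@(_∷_ {Γ = Γ₂} {υ = τ₂} _ []) , d ← family Is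
  with G₂ ∷ [] ← Family-ren {g = join f g} odd-injective (join-odd f g) F
  with (d ∷ []) ∷ _ ← even-odd-apart {tvᴿ Γ (var α)} d
  -- `σ` is exchanged for its linear form `ι υ`, which supplies the value of the new result
  -- variable.
  = Infers-resp (↭-reflexive (cong (Δ ++_) (sym (++-identityʳ Δ₂)))) υ≈σ
      (infer-app-var
        (Generalizes-ren even-injective (join-even f g) (record
          { consistent = consistent G
          ; inferred   = inferred G
          ; type       = ≈₂-trans (type G) (τ ⊸ ≈₂-sym υ≈σ)
          ; context    = context G
          }))
        G₂
        (subst₂ Disjoint (sym (tvᴿ-ren even Γ (var α))) (sym (tvᴬ-ren odd (Γ₂ , τ₂))) d))
infer-app {M₁} {M₂} {Δ = Δ} {Δs} {σ} τ⃗ (Γ , σ′ , f , G) Is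
  | inj₂ (υ⃗ , ρ , refl , υ≈τ , ρ≈σ)
  -- The inferred domain agrees with `τ⃗` only up to order. UNIFY pairs types by position, so the
  -- arguments are rearranged to follow `υ⃗`.
  with Δs′ , p , Is′ ← Pointwise-↭ Is (↭-sym υ≈τ)
  with g , Rs , F , d ← family Is′
  = Infers-resp (++⁺ˡ Δ (concat-↭ (↭-sym p))) (≈₂-refl σ)
      (infer-app-⟶ {τ⃗ = τ⃗} {υ⃗ = sub₁ (var ∘ even) υ⃗} {ρ = sub₂ (var ∘ even) ρ} {Rs = map (renᴬ odd) Rs}
        (subst (Generalizes h M₁ Δ (τ⃗ ⟶ σ) (subᵉ (var ∘ even) Γ)) (sub₂-⟶ (var ∘ even) υ⃗ ρ)
          (Generalizes-ren even-injective (join-even f g) G))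
        (≈₂-trans (≈₂-reflexive (trans (sub₂-∘ h _ ρ) (sub₂-cong ρ λ {α} _ → join-even f g α))) ρ≈σ)
        (subst (λ τs → Family h M₂ Δs′ τs (map (renᴬ odd) Rs)) types
          (Family-ren odd-injective (join-odd f g) F))
        (subst (AllPairs Disjoint)
          (sym (cong₂ _∷_
            (trans (cong (tvᴿ (subᵉ (var ∘ even) Γ)) (sym (sub₂-⟶ (var ∘ even) υ⃗ ρ)))
              (tvᴿ-ren even Γ (υ⃗ ⟶ ρ)))
            (tvᴬs-ren odd Rs)))
          (even-odd-apart d)))
  where
  h = join f g
  types : toList (sub₁ f υ⃗) ≡ map (sub₀ h) (toList (sub₁ (var ∘ even) υ⃗))
  types = cong toList (sym (trans (sub₁-∘ h _ υ⃗) (sub₁-cong υ⃗ λ {α} _ → join-even f g α)))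

-- `x` is declared in the instance of `Γ`, hence in `Γ` itself, since instantiation keeps variables
-- and lengths of sequences. So `T` does not fail, and it forms the same kind of arrow.
infer-lam : ∀ {Δ x M σ} τ⃗ → x ∉ dom Δ → Infers M (block x τ⃗ ++ Δ) σ → Infers (ƛ x M) Δ (τ⃗ ⟶ σ)
infer-lam {Δ} {x} {σ = σ} τ⃗ x∉ (Γ , σ′ , f , G)
  with _ , d∈ , υ≈τ , p ← extract {subᵉ f Γ} {τ⃗ = τ⃗} (sub-consistent (consistent G)) (context G) x∉
  with (_ , υ⃗) , e∈ , refl ← ∈-map⁻ (map₂ (sub₁ f)) d∈
  = Γ ∖ x , υ⃗ ⟶ σ′ , f , record
  { consistent = Unique-filter _ (consistent G)
  ; inferred   = T-lam υ⃗ (inferred G) e∈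
  ; type       = ≈₂-trans (≈₂-reflexive (sub₂-⟶ f υ⃗ σ′)) (⟶-cong (sub₁ f υ⃗) τ⃗ υ≈τ (type G))
  ; context    = ↭-trans (↭-reflexive (cong flat (sym (sub-without f x Γ)))) p
  }

infer : ∀ {Δ M σ} → Δ ⊩ M ∶ σ → Infers M Δ σ
infers : ∀ {Δs M τs} → Pointwise (λ Δ τ → Δ ⊩ M ∶ ι τ) Δs τs → Pointwise (λ Δ τ → Infers M Δ (ι τ)) Δs τs

infer (var {x} {τ}) = [ x ∶₀ var 0 ] , var 0 , (λ _ → τ) , record
  { consistent = [] ∷ []
  ; inferred   = T-var
  ; type       = ≈₂-refl (ι τ)
  ; context    = ↭-refl
  }
infer (lam {τ⃗ = τ⃗} x∉ D)  = infer-lam τ⃗ x∉ (infer D)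
infer (app {τ⃗ = τ⃗} D Ds)  = infer-app τ⃗ (infer D) (infers Ds)
infer (conv p q D)         = Infers-resp p q (infer D)

infers []       = []
infers (D ∷ Ds) = infer D ∷ infers Ds

-- Passage to a finite substitution

-- Only the finitely many variables of the inferred result matter for its instance; repetitions are
-- removed because a `Subst` has distinct variables.
restrict : (TVar → L0) → List TVar → Subst
restrict f αs = mkSubst (map (λ α → α , f α) (deduplicate _≟_ αs))
  (subst Unique (trans (sym (map-id _)) (map-∘ (deduplicate _≟_ αs))) (deduplicate-! _≟_ αs))

restrict-∈ : ∀ f {α} αs → α ∈ αs → ⟦ restrict f αs ⟧ α ≡ f α
restrict-∈ f {α} αs α∈ = cong (fromMaybe (var α)) (found (deduplicate _≟_ αs) (∈-deduplicate⁺ _≟_ α∈))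
  where
  found : ∀ βs → α ∈ βs → lookup α (map (λ β → β , f β) βs) ≡ just (f α)
  found (β ∷ βs) α∈ with α ≟ β
  ... | yes refl = refl
  found (β ∷ βs) (here α≡β)  | no α≢β = contradiction α≡β α≢β
  found (β ∷ βs) (there α∈) | no _   = found βs α∈

theorem35 : (M : Λ) (Γ : Env) (σ : L2) → Consistent Γ → Γ ⊢₂ M ∶ σ →
    ∃[ Γ′ ] ∃[ σ′ ] (Consistent Γ′ × T M Γ′ σ′ ×
    (∃[ S ] (sub₂ ⟦ S ⟧ σ′ ≈₂ σ × subᵉ ⟦ S ⟧ Γ′ ≋ Γ)))
theorem35 M Γ σ c D with Γ′ , σ′ , f , G ← infer (⊢₂⇒⊩ D)
  with H ← Generalizes-cong {g = ⟦ restrict f (tvᴿ Γ′ σ′) ⟧} (restrict-∈ f (tvᴿ Γ′ σ′)) G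
  = Γ′ , σ′ , consistent H , inferred H , restrict f (tvᴿ Γ′ σ′) , type H
  , flat-↭⇒≋ (sub-consistent (consistent H)) c (context H)
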